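{- Let $F$ be a field of characteristic zero. For every $n\ge1$ and all compositions $\lambda,\eta$, one has in $\mathrm{NSym}$ (over $F$) $$\mathbf s_{(n)}\,\mathbf s_{\lambda/\eta}=\sum_{a+b=n,\ a,b\ge0}(-1)^b\sum_{\substack{\rho,\mu:\ \lambda\xrightarrow{\mathrm{LH}}_a\rho \\ \mu\xrightarrow{\mathrm{LV}}_b\eta}}\mathbf s_{\rho/\mu},\qquad \mathbf s_{(1^n)}\,\mathbf s_{\lambda/\eta}=\sum_{a+b=n,\ a,b\ge0}(-1)^b\sum_{\substack{\rho,\mu:\ \lambda\xrightarrow{\mathrm{LV}}_a\rho \\ \mu\xrightarrow{\mathrm{LH}}_b\eta}}\mathbf s_{\rho/\mu}.$$
   Context: $\mathrm{NSym}=F\langle H_1,H_2,\dots\rangle$ with $\Delta(H_r)=\sum_{i+j=r}H_i\otimes H_j$ ($H_0=1$), graded Hopf dual to $\mathrm{QSym}$ via $\langle H_\alpha,M_\beta\rangle=\delta_{\alpha\beta}$ ($H_\alpha=H_{\alpha_1}H_{\alpha_2}\cdots$, $M_\beta$ monomial quasisymmetric functions). The noncommutative Schur functions $\mathbf s_\alpha$ are the basis of $\mathrm{NSym}$ dual to the quasisymmetric Schur functions $\mathcal S_\alpha$, where $\mathcal S_\alpha=\sum_Tx^T$ over fillings $T$ of the diagram of $\alpha$ (row $i$ from the top has $\alpha_i$ left-justified boxes) by positive integers with rows weakly decreasing left to right, first column strictly increasing top to bottom, and, extending $T$ by zeros to a rectangle, for $i<j$, $c\ge2$: $T(j,c)\ne0$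 and $T(j,c)\ge T(i,c)$ imply $T(j,c)>T(i,c-1)$. Skew elements: $\Delta(\mathbf s_\lambda)=\sum_\eta\mathbf s_{\lambda/\eta}\otimes\mathbf s_\eta$. **Left strips.** For a composition $\alpha$: $t_1(\alpha)=(1,\alpha_1,\dots,\alpha_\ell)$; for $i\ge2$, $t_i(\alpha)$ is obtained by adding $1$ to the leftmost part of $\alpha$ equal to $i-1$, and $t_i(\alpha)=0$ if there is no such part; $0$ is a formal absorbing symbol, $t_j(0)=0$. For $m>0$, $\alpha\xrightarrow{\mathrm{LH}}_m\beta$ means $\beta=t_{i_m}\cdots t_{i_1}(\alpha)$ for some $1\le i_1<\cdots<i_m$, and $\alpha\xrightarrow{\mathrm{LV}}_m\beta$ means $\beta=t_{i_m}\cdots t_{i_1}(\alpha)$ for some $i_1\ge\cdots\ge i_m\ge1$ (here $\alpha,\beta$ are genuine compositions). For $m=0$ both relations mean $\alpha=\beta$. -}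

module Defs where

open import Algebra.Apartness.Bundles using (HeytingCommutativeRing; HeytingField)
open import Algebra.Bundles using (CommutativeRing; Semiring)
open import Data.Bool.Base using (true; false; if_then_else_) renaming (T to True)
open import Data.Fin.Base using (Fin; toℕ)
import Data.Fin.Properties as Fin
open import Data.List.Base
  using (List; []; _∷_; [_]; _++_; map; concat; concatMap;
         cartesianProductWith; filter; foldr; length; mapMaybe; replicate; upTo; applyUpTo)
open import Data.List.Membership.Propositional using (_∈_; _∉_; lose; find)
open import Data.List.Membership.Propositional.Properties
  using (∈-++⁺ˡ; ∈-++⁺ʳ; ∈-map⁺; ∈-map⁻; ∈-cartesianProductWith⁺; ∈-upTo⁺; ∈-filter⁺; ∈-filter⁻)
open import Data.List.Properties using (≡-dec; filter-all; ∷-injective)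
open import Data.List.Relation.Unary.All as All using (All; []; _∷_)
open import Data.List.Relation.Unary.AllPairs using (AllPairs; []; _∷_; allPairs?)
open import Data.List.Relation.Unary.Any using (here; there; any?)
open import Data.List.Relation.Unary.Linked using (Linked; linked?)
open import Data.List.Relation.Unary.Unique.Propositional using (Unique)
import Data.List.Relation.Unary.Unique.Propositional.Properties as Unique
open import Data.Maybe.Base as Maybe using (Maybe; just; nothing; _>>=_)
import Data.Maybe.Properties as Maybe
open import Data.Nat.Base
  using (ℕ; zero; suc; _+_; _∸_; _≤_; _<_; _≥_; _>_; _≡ᵇ_; z≤n; s≤s; NonZero)
import Data.Nat.Properties as ℕ
open import Data.Product.Base using (∃-syntax; _×_; _,_; proj₁; proj₂)
open import Data.Product.Properties using () renaming (≡-dec to ×-≡-dec)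
open import Data.Vec.Base using (Vec; []; _∷_)
open import Data.Vec.Relation.Unary.All using ([]; _∷_) renaming (All to VAll)
import Data.Vec.Relation.Unary.Linked as V
open import Function.Base using (_∘_)
open import Function.Bundles using (_⇔_; mk⇔)
open import Level using (Level; _⊔_)
open import Relation.Binary.Core using (Rel)
open import Relation.Binary.Definitions using (DecidableEquality; Decidable)
open import Relation.Binary.PropositionalEquality
  using (_≡_; _≢_; refl; sym; trans; cong; subst)
open import Relation.Nullary using (¬_; Dec; yes; no; does; contradiction)
open import Relation.Nullary.Decidable using (map′; _×-dec_; _→-dec_; ¬?)

private
  variable
    a b : Level

------------------------------------------------------------------------
-- Compositions

-- The non-zero proof is irrelevant, so parts are equal as soon as their
-- values are.
record Part : Set where
  constructor part
  field
    value      : ℕ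
    .{{positive}} : NonZero value

open Part public using (value)

Composition : Set
Composition = List Part

parts : Composition → List ℕ
parts = map value

size : Composition → ℕ
size α = foldr _+_ 0 (parts α)

1ᵖ : Part
1ᵖ = part 1

sucᵖ : Part → Part
sucᵖ p = part (suc (value p))

⟨_⟩ : (n : ℕ) .{{_ : NonZero n}} → Composition
⟨ n ⟩ = [ part n ]

⟨1^_⟩ : ℕ → Composition
⟨1^ n ⟩ = replicate n 1ᵖ

infix 4 _≟ᵖ_ _≟_

_≟ᵖ_ : DecidableEquality Part
part m ≟ᵖ part n = map′ (λ { refl → refl }) (cong value) (m ℕ.≟ n)

_≟_ : DecidableEquality Composition
_≟_ = ≡-dec _≟ᵖ_

bumpFirst : Composition → Maybe Composition
bumpFirst []      = nothing
bumpFirst (p ∷ α) = just (sucᵖ p ∷ α)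

compositions : ℕ → List Composition
compositions zero    = [ [] ]
compositions (suc n) = map (1ᵖ ∷_) (compositions n) ++ mapMaybe bumpFirst (compositions n)

------------------------------------------------------------------------
-- Left strips

bumpLeftmost : ℕ → Composition → Maybe Composition
bumpLeftmost k []      = nothing
bumpLeftmost k (p ∷ α) =
  if value p ≡ᵇ k
  then just (sucᵖ p ∷ α)
  else Maybe.map (p ∷_) (bumpLeftmost k α)

-- `nothing` is the formal symbol 0.  Operators are indexed by i ≥ 1; the
-- value at i = 0 makes every sequence of indices containing 0 yield the
-- formal 0.
t : ℕ → Composition → Maybe Composition
t zero          α = nothing
t (suc zero)    α = just (1ᵖ ∷ α)
t (suc (suc k)) α = bumpLeftmost (suc k) α

-- t* (i₁ ∷ … ∷ iₘ ∷ []) = t iₘ ∘ … ∘ t i₁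
t* : ∀ {m} → Vec ℕ m → Composition → Maybe Composition
t* []       α = just α
t* (i ∷ is) α = t i α >>= t* is

Strip : Rel ℕ Level.zero → ℕ → Composition → Composition → Set
Strip _R_ m α β = ∃[ is ] V.Linked _R_ {m} is × t* is α ≡ just β

infix 4 _⟶LH[_]_ _⟶LV[_]_

_⟶LH[_]_ : Composition → ℕ → Composition → Set
α ⟶LH[ m ] β = Strip _<_ m α β

_⟶LV[_]_ : Composition → ℕ → Composition → Set
α ⟶LV[ m ] β = Strip _≥_ m α β

vectors : ℕ → (m : ℕ) → List (Vec ℕ m)
vectors N zero    = [ [] ]
vectors N (suc m) = cartesianProductWith _∷_ (upTo N) (vectors N m)

∈-vectors : ∀ {N m} {is : Vec ℕ m} → VAll (_< N) is → is ∈ vectors N m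
∈-vectors []         = here refl
∈-vectors (i<N ∷ is) = ∈-cartesianProductWith⁺ _∷_ (∈-upTo⁺ i<N) (∈-vectors is)

bumpLeftmost-size : ∀ k α {β} → bumpLeftmost k α ≡ just β →
                    size β ≡ suc (size α) × suc k ≤ size β
bumpLeftmost-size k (p ∷ α) eq with value p ≡ᵇ k in p≡k
bumpLeftmost-size k (p ∷ α) refl | true
  rewrite ℕ.≡ᵇ⇒≡ (value p) k (subst True (sym p≡k) _) = refl , s≤s (ℕ.m≤m+n k (size α))
bumpLeftmost-size k (p ∷ α) eq   | false with bumpLeftmost k α in eq′
bumpLeftmost-size k (p ∷ α) refl | false | just γ =
  let (sz , k<) = bumpLeftmost-size k α eq′ in
  trans (cong (value p +_) sz) (ℕ.+-suc (value p) (size α)) ,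
  ℕ.≤-trans k< (ℕ.m≤n+m (size γ) (value p))

t-size : ∀ i α {β} → t i α ≡ just β → size β ≡ suc (size α) × i ≤ size β
t-size (suc zero)    α refl = refl , s≤s z≤n
t-size (suc (suc k)) α eq   = bumpLeftmost-size (suc k) α eq

t*-size : ∀ {m} (is : Vec ℕ m) α {β} → t* is α ≡ just β →
          size β ≡ size α + m × VAll (_< suc (size β)) is
t*-size []       α refl = sym (ℕ.+-identityʳ (size α)) , []
t*-size {suc m} (i ∷ is) α {β} eq with t i α in eq′
... | just γ =
  let (szγ , i≤) = t-size i α eq′
      (szβ , is≤) = t*-size is γ eq
  in trans szβ (trans (cong (_+ m) szγ) (sym (ℕ.+-suc (size α) m))) ,
     s≤s (ℕ.≤-trans i≤ (subst (size γ ≤_) (sym szβ) (ℕ.m≤m+n (size γ) m))) ∷ is≤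

strip? : ∀ {_R_ : Rel ℕ Level.zero} → Decidable _R_ → ∀ m → Decidable (Strip _R_ m)
strip? R? m α β = map′
  (λ p → let (is , _ , q) = find p in is , q)
  (λ (is , linked , eq) → lose (∈-vectors (proj₂ (t*-size is α eq))) (linked , eq))
  (any? (λ is → V.linked? R? is ×-dec Maybe.≡-dec _≟_ (t* is α) (just β))
        (vectors (suc (size β)) m))

stripsFrom : ∀ {_R_ : Rel ℕ Level.zero} → Decidable _R_ → ℕ → Composition → List Composition
stripsFrom R? m α = filter (λ β → strip? R? m α β) (compositions (size α + m))

stripsTo : ∀ {_R_ : Rel ℕ Level.zero} → Decidable _R_ → ℕ → Composition → List Composition
stripsTo R? m β = filter (λ α → strip? R? m α β) (compositions (size β ∸ m))

-- The lists of all β with α ⟶ β, and of all α with α ⟶ β; see ∈-stripsFrom,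
-- ∈-stripsTo, stripsFrom-unique and stripsTo-unique.
LH-from LV-from LH-to LV-to : ℕ → Composition → List Composition
LH-from = stripsFrom ℕ._<?_
LV-from = stripsFrom ℕ._≥?_
LH-to   = stripsTo ℕ._<?_
LV-to   = stripsTo ℕ._≥?_

bumpFirst-injective : ∀ α β {γ} → bumpFirst α ≡ just γ → bumpFirst β ≡ just γ → α ≡ β
bumpFirst-injective (part m ∷ α) (part .m ∷ .α) refl refl = refl

∈-mapMaybe⁺ : ∀ {A : Set a} {B : Set b} (f : A → Maybe B) {x y xs} →
              x ∈ xs → f x ≡ just y → y ∈ mapMaybe f xs
∈-mapMaybe⁺ f {xs = x ∷ xs} (here refl) eq with just _ ← f x | refl ← eq = here refl
∈-mapMaybe⁺ f {xs = x ∷ xs} (there x∈)  eq with f x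
... | just _  = there (∈-mapMaybe⁺ f x∈ eq)
... | nothing = ∈-mapMaybe⁺ f x∈ eq

∈-mapMaybe⁻ : ∀ {A : Set a} {B : Set b} (f : A → Maybe B) {y} xs →
              y ∈ mapMaybe f xs → ∃[ x ] x ∈ xs × f x ≡ just y
∈-mapMaybe⁻ f (x ∷ xs) y∈ with f x in eq
∈-mapMaybe⁻ f (x ∷ xs) (here refl) | just _ = x , here refl , eq
∈-mapMaybe⁻ f (x ∷ xs) (there y∈)  | just _ =
  let (z , z∈ , q) = ∈-mapMaybe⁻ f xs y∈ in z , there z∈ , q
∈-mapMaybe⁻ f (x ∷ xs) y∈          | nothing =
  let (z , z∈ , q) = ∈-mapMaybe⁻ f xs y∈ in z , there z∈ , q

∈-compositions : ∀ {n} α → size α ≡ n → α ∈ compositions n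
∈-compositions {zero}  []                       refl = here refl
∈-compositions {zero}  (part (suc _) ∷ α)       ()
∈-compositions {suc n} (part (suc zero) ∷ α)    eq   =
  ∈-++⁺ˡ (∈-map⁺ (1ᵖ ∷_) (∈-compositions α (ℕ.suc-injective eq)))
∈-compositions {suc n} (part (suc (suc k)) ∷ α) eq   =
  ∈-++⁺ʳ (map (1ᵖ ∷_) (compositions n))
    (∈-mapMaybe⁺ bumpFirst (∈-compositions (part (suc k) ∷ α) (ℕ.suc-injective eq)) refl)

mapMaybe-bumpFirst-unique : ∀ {αs} → Unique αs → Unique (mapMaybe bumpFirst αs)
mapMaybe-bumpFirst-unique {[]} [] = []
mapMaybe-bumpFirst-unique {α ∷ αs} (α∉ ∷ u) with bumpFirst α in eq
... | nothing = mapMaybe-bumpFirst-unique u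
... | just β  = All.tabulate fresh ∷ mapMaybe-bumpFirst-unique u
  where
  fresh : ∀ {γ} → γ ∈ mapMaybe bumpFirst αs → β ≢ γ
  fresh γ∈ refl = let (α′ , α′∈ , eq′) = ∈-mapMaybe⁻ bumpFirst αs γ∈ in
    All.lookup α∉ α′∈ (bumpFirst-injective α α′ eq eq′)

compositions-unique : ∀ n → Unique (compositions n)
compositions-unique zero    = [] ∷ []
compositions-unique (suc n) = Unique.++⁺
  (Unique.map⁺ (λ { refl → refl }) (compositions-unique n))
  (mapMaybe-bumpFirst-unique (compositions-unique n))
  λ (p , q) → disjoint p q
  where
  disjoint : ∀ {γ} → γ ∈ map (1ᵖ ∷_) (compositions n) →
             ¬ γ ∈ mapMaybe bumpFirst (compositions n)
  disjoint p q with ∈-map⁻ (1ᵖ ∷_) p | ∈-mapMaybe⁻ bumpFirst (compositions n) q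
  ... | _ , _ , refl | (part (suc k) ∷ _) , _ , ()

module _ {_R_ : Rel ℕ Level.zero} (R? : Decidable _R_) (m : ℕ) where

  ∈-stripsFrom : ∀ α β → β ∈ stripsFrom R? m α ⇔ Strip _R_ m α β
  ∈-stripsFrom α β = mk⇔
    (proj₂ ∘ ∈-filter⁻ (λ γ → strip? R? m α γ) {xs = compositions (size α + m)})
    (λ s@(is , _ , eq) →
      ∈-filter⁺ (λ γ → strip? R? m α γ) (∈-compositions β (proj₁ (t*-size is α eq))) s)

  ∈-stripsTo : ∀ α β → α ∈ stripsTo R? m β ⇔ Strip _R_ m α β
  ∈-stripsTo α β = mk⇔
    (proj₂ ∘ ∈-filter⁻ (λ γ → strip? R? m γ β) {xs = compositions (size β ∸ m)})
    (λ s@(is , _ , eq) →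
      ∈-filter⁺ (λ γ → strip? R? m γ β)
        (∈-compositions α
          (sym (trans (cong (_∸ m) (proj₁ (t*-size is α eq))) (ℕ.m+n∸n≡m (size α) m))))
        s)

  stripsFrom-unique : ∀ α → Unique (stripsFrom R? m α)
  stripsFrom-unique α =
    Unique.filter⁺ (λ γ → strip? R? m α γ) (compositions-unique (size α + m))

  stripsTo-unique : ∀ β → Unique (stripsTo R? m β)
  stripsTo-unique β =
    Unique.filter⁺ (λ γ → strip? R? m γ β) (compositions-unique (size β ∸ m))

------------------------------------------------------------------------
-- Fillings

-- A filling is its list of rows, from the top.
Filling : Set
Filling = List (List ℕ)

-- Extension by zeros; columns are numbered from 0.
entry : List ℕ → ℕ → ℕ
entry []       _       = 0
entry (x ∷ xs) zero    = x
entry (x ∷ xs) (suc c) = entry xs c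

-- The triple condition for a row and a lower row.  For columns suc c beyond
-- the end of the lower row its entry is 0, so nothing is required there.
Triple : Rel (List ℕ) Level.zero
Triple upper lower = (c : Fin (length lower)) →
  entry lower (suc (toℕ c)) ≢ 0 →
  entry lower (suc (toℕ c)) ≥ entry upper (suc (toℕ c)) →
  entry lower (suc (toℕ c)) > entry upper (toℕ c)

triple? : Decidable Triple
triple? upper lower = Fin.all? λ c →
  ¬? (entry lower (suc (toℕ c)) ℕ.≟ 0) →-dec
  ((entry lower (suc (toℕ c)) ℕ.≥? entry upper (suc (toℕ c))) →-dec
   (entry lower (suc (toℕ c)) ℕ.>? entry upper (toℕ c)))

-- The conditions on fillings by positive integers; AllPairs relates each row
-- to every lower one.
IsTableau : Filling → Set
IsTableau T =
  All (Linked _≥_) T ×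
  AllPairs (λ upper lower → entry upper 0 < entry lower 0) T ×
  AllPairs Triple T

isTableau? : (T : Filling) → Dec (IsTableau T)
isTableau? T =
  All.all? (linked? ℕ._≥?_) T ×-dec
  allPairs? (λ upper lower → entry upper 0 ℕ.<? entry lower 0) T ×-dec
  allPairs? triple? T

rows : ℕ → ℕ → List (List ℕ)
rows k zero    = [ [] ]
rows k (suc n) = cartesianProductWith _∷_ (applyUpTo suc k) (rows k n)

-- All fillings of the diagram of α with entries in {1, …, k}.
fillings : ℕ → Composition → List Filling
fillings k []      = [ [] ]
fillings k (p ∷ α) = cartesianProductWith _∷_ (rows k (value p)) (fillings k α)

-- The list (e₁, …, eₖ) stands for the monomial x₁^e₁ ⋯ xₖ^eₖ; trailing zeros
-- are allowed.
Exponents : Set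
Exponents = List ℕ

infix 4 _≟ᵉ_

_≟ᵉ_ : DecidableEquality Exponents
_≟ᵉ_ = ≡-dec ℕ._≟_

multiplicity : ℕ → List ℕ → ℕ
multiplicity i xs = length (filter (i ℕ.≟_) xs)

-- The exponents of x^T, for T with entries in {1, …, k}.
content : ℕ → Filling → Exponents
content k T = applyUpTo (λ i → multiplicity (suc i) (concat T)) k

------------------------------------------------------------------------
-- NSym over a field F

splits : ℕ → List (ℕ × ℕ)
splits n = map (λ i → i , n ∸ i) (upTo (suc n))

module Over {c ℓ₁ ℓ₂} (F : HeytingField c ℓ₁ ℓ₂) where

  ring : CommutativeRing c ℓ₁
  ring = HeytingCommutativeRing.commutativeRing (HeytingField.heytingCommutativeRing F)

  open CommutativeRing ring public
    using (Carrier; _≈_; _≉_; 0#; 1#; -_)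
    renaming (_+_ to _+ᶠ_; _*_ to _*ᶠ_)
  open CommutativeRing ring using (semiring; +-identityʳ; *-identityˡ; *-identityʳ) renaming (trans to ≈-trans)
  open import Algebra.Definitions.RawSemiring (Semiring.rawSemiring semiring) public
    using (_^_) renaming (_×_ to _×ᶠ_)

  CharacteristicZero : Set ℓ₁
  CharacteristicZero = ∀ n → suc n ×ᶠ 1# ≉ 0#

  ----------------------------------------------------------------------
  -- Formal linear combinations

  -- A term (k , x) is k times the basis element x; a basis element may occur
  -- in several terms, and the meaningful equality is _≈[_]_ below.
  Lin : ∀ {a} → Set a → Set (c ⊔ a)
  Lin A = List (Carrier × A)

  module _ {a} {A : Set a} where

    basis : A → Lin A
    basis x = [ 1# , x ]

    infixr 7 _·_

    _·_ : Carrier → Lin A → Lin A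
    k · v = map (λ (l , x) → k *ᶠ l , x) v

    ∑ : ∀ {i} {I : Set i} → List I → (I → Lin A) → Lin A
    ∑ is f = concatMap f is

    coefficient : DecidableEquality A → Lin A → A → Carrier
    coefficient _≟ᴬ_ v x =
      foldr (λ (k , y) s → (if does (y ≟ᴬ x) then k else 0#) +ᶠ s) 0# v

    infix 4 _≈[_]_

    _≈[_]_ : Lin A → DecidableEquality A → Lin A → Set (a ⊔ ℓ₁)
    v ≈[ _≟ᴬ_ ] w = ∀ x → coefficient _≟ᴬ_ v x ≈ coefficient _≟ᴬ_ w x

  linear : ∀ {a b} {A : Set a} {B : Set b} → (A → Lin B) → Lin A → Lin B
  linear f v = ∑ v (λ (k , x) → k · f x)

  bilinear : ∀ {a b d} {A : Set a} {B : Set b} {D : Set d} →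
             (A → B → D) → Lin A → Lin B → Lin D
  bilinear f = cartesianProductWith λ (k , x) (l , y) → k *ᶠ l , f x y

  δ : Composition → Composition → Carrier
  δ α β = if does (α ≟ β) then 1# else 0#

  ----------------------------------------------------------------------
  -- The Hopf algebra NSym

  -- The free algebra on H₁, H₂, …, with the words H_α as linear basis.
  NSym : Set c
  NSym = Lin Composition

  NSym⊗NSym : Set c
  NSym⊗NSym = Lin (Composition × Composition)

  infix 4 _≈ᴺ_ _≈⊗_

  _≈ᴺ_ : NSym → NSym → Set ℓ₁
  x ≈ᴺ y = x ≈[ _≟_ ] y

  _≈⊗_ : NSym⊗NSym → NSym⊗NSym → Set ℓ₁
  x ≈⊗ y = x ≈[ ×-≡-dec _≟_ _≟_ ] y

  infixl 7 _∙_ _∙⊗_ _⊗_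

  _∙_ : NSym → NSym → NSym
  _∙_ = bilinear _++_

  _⊗_ : NSym → NSym → NSym⊗NSym
  _⊗_ = bilinear _,_

  _∙⊗_ : NSym⊗NSym → NSym⊗NSym → NSym⊗NSym
  _∙⊗_ = bilinear λ (α , β) (γ , ε) → α ++ γ , β ++ ε

  H : ℕ → NSym
  H zero      = basis []
  H r@(suc _) = basis ⟨ r ⟩

  ΔH : Part → NSym⊗NSym
  ΔH r = ∑ (splits (value r)) λ (i , j) → H i ⊗ H j

  Δ : NSym → NSym⊗NSym
  Δ = linear (foldr (λ r → ΔH r ∙⊗_) (basis ([] , [])))

  ----------------------------------------------------------------------
  -- Quasisymmetric functions and duality

  -- Formal power series in x₁, x₂, …, given by their coefficients.
  Series : Set c
  Series = Exponents → Carrier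

  nonzeros : Exponents → List ℕ
  nonzeros = filter (0 ℕ.<?_)

  -- x^e occurs in M_β, with coefficient 1, exactly when the non-zero
  -- exponents of e are, in order, the parts of β.
  M : Composition → Series
  M β e = if does (nonzeros e ≟ᵉ parts β) then 1# else 0#

  -- 𝒮_α = ∑ x^T.  Entries exceeding the length of e cannot occur in a T with
  -- x^T = x^e.
  𝒮 : Composition → Series
  𝒮 α e = length (filter
    (λ T → isTableau? T ×-dec (content (length e) T ≟ᵉ e))
    (fillings (length e) α)) ×ᶠ 1#

  -- A quasisymmetric f is ∑_β f(β) M_β, where f(β) is its coefficient at
  -- x₁^β₁ ⋯ xₗ^βₗ, so the pairing with ⟨ H_α , M_β ⟩ = δ_αβ (see H-M-dual) has
  -- ⟨ H_α , f ⟩ = f(α).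
  ⟪_,_⟫ : NSym → Series → Carrier
  ⟪ x , f ⟫ = foldr (λ (k , α) s → k *ᶠ f (parts α) +ᶠ s) 0# x

  nonzeros-parts : ∀ α → nonzeros (parts α) ≡ parts α
  nonzeros-parts α = filter-all (0 ℕ.<?_) (positive α)
    where
    positive : ∀ α → All (0 <_) (parts α)
    positive []                 = []
    positive (part (suc k) ∷ α) = s≤s z≤n ∷ positive α

  parts-injective : ∀ {α β} → parts α ≡ parts β → α ≡ β
  parts-injective {[]}         {[]}         _  = refl
  parts-injective {part m ∷ α} {part n ∷ β} eq with refl , eq′ ← ∷-injective eq =
    cong (part m ∷_) (parts-injective eq′)

  H-M-dual : ∀ α β → ⟪ basis α , M β ⟫ ≈ δ α β
  H-M-dual α β rewrite nonzeros-parts α with parts α ≟ᵉ parts β | α ≟ β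
  ... | yes _ | yes _    = ≈-trans (+-identityʳ _) (*-identityʳ 1#)
  ... | no  _ | no  _    = ≈-trans (+-identityʳ _) (*-identityˡ 0#)
  ... | yes p | no  α≢β  = contradiction (parts-injective p) α≢β
  ... | no  p | yes refl = contradiction refl p

  ----------------------------------------------------------------------
  -- Noncommutative Schur functions

  record IsBasis (b : Composition → NSym) : Set (c ⊔ ℓ₁) where
    field
      spanning    : ∀ x → ∃[ k ] linear b k ≈ᴺ x
      independent : ∀ k → linear b k ≈ᴺ [] → k ≈ᴺ []

  -- Determines s up to _≈ᴺ_.
  record IsNoncommutativeSchur (s : Composition → NSym) : Set (c ⊔ ℓ₁) where
    field
      isBasis : IsBasis s
      dual    : ∀ α β → ⟪ s α , 𝒮 β ⟫ ≈ δ α β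

  -- sk α η plays the role of s_{α/η}: for every α, only finitely many
  -- sk α η are non-zero, and Δ(s_α) = ∑_η sk α η ⊗ s_η.
  record IsSkew (s : Composition → NSym) (sk : Composition → Composition → NSym)
         : Set (c ⊔ ℓ₁) where
    field
      support : Composition → List Composition
      unique  : ∀ α → Unique (support α)
      zeros   : ∀ α η → η ∉ support α → sk α η ≈ᴺ []
      expand  : ∀ α → Δ (s α) ≈⊗ ∑ (support α) λ η → sk α η ⊗ s η

{-# OPTIONS --safe #-}

-- A field-valued functional p on words extends to NSym, and NSym elements are
-- compared through these extensions.  Removing the ones from a composition
-- tableau and lowering the other entries shows that the coefficient of M_(n,γ)
-- in 𝒮_β is the sum of those of M_γ in 𝒮_α over the strips α ⟶LH[ n ] β; dually
-- Hₙ s_α = ∑ s_ρ over α ⟶LH[ n ] ρ, and applying Δ gives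
--   ∑_{λ ⟶LH[ n ] ρ} s_{ρ/μ} = ∑_{i+j=n} Hᵢ ∑_{θ ⟶LH[ j ] μ} s_{λ/θ}.
-- A strip determines its word, so LH and LV strips correspond to increasing and
-- weakly decreasing words of operators t.  In an alternating sum over an
-- increasing word followed by a weakly decreasing one (or vice versa) moving the
-- letter at the boundary is a sign-reversing involution.  Hence the two kinds of
-- strips are inverse to each other as signed power series, which turns the
-- displayed identity into the first formula.  Both sides of the second formula
-- satisfy the recursion expressing that they are E(t) = H(-t)⁻¹ times s_{λ/η}.

module Submission where

open import Defs
open import Algebra.Apartness.Bundles using (HeytingField)
open import Algebra.Bundles using (CommutativeMonoid; CommutativeRing; Semiring)
open import Data.Bool.Base using (true; false; if_then_else_) renaming (T to True)
open import Data.Fin.Base using (toℕ; fromℕ<)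
open import Data.Fin.Properties using (toℕ-fromℕ<)
open import Data.List.Base
  using (List; []; _∷_; _++_; map; concat; concatMap; cartesianProductWith; deduplicate;
         filter; foldr; length; zipWith; applyUpTo; upTo)
open import Data.List.Membership.Propositional using (_∈_; lose; find)
open import Data.List.Membership.Propositional.Properties
  using (∈-∃++; ∈-++⁺ˡ; ∈-++⁺ʳ; ∈-++⁻; ∈-map⁺; ∈-filter⁺; ∈-filter⁻; ∈-upTo⁺; ∈-applyUpTo⁺; ∈-applyUpTo⁻;
         ∈-cartesianProductWith⁺; ∈-cartesianProductWith⁻; ∈-concatMap⁺; ∈-concatMap⁻; ∈-deduplicate⁺)
import Data.List.Membership.DecPropositional as DecMembership
open import Data.List.Properties
  using (map-injective; map-applyUpTo; length-map; length-++; map-∘; map-cong; map-cong-local;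
         ∷-injective; filter-accept; filter-reject; ++-identityʳ; ++-assoc)
open import Data.List.Relation.Binary.Pointwise as Pointwise using (Pointwise; []; _∷_)
open import Data.List.Relation.Unary.All as All using (All; []; _∷_)
import Data.List.Relation.Unary.All.Properties as All
open import Data.List.Relation.Unary.AllPairs as AllPairs using (AllPairs; []; _∷_)
import Data.List.Relation.Unary.AllPairs.Properties as AllPairs
open import Data.List.Relation.Unary.Any using (here; there)
open import Data.List.Relation.Unary.Linked using (Linked; []; [-]; _∷_)
open import Data.List.Relation.Unary.Unique.Propositional using (Unique)
import Data.List.Relation.Unary.Unique.Propositional.Properties as Unique
open import Data.List.Relation.Unary.Unique.DecPropositional.Properties using (deduplicate-!)
open import Data.Maybe.Base using (Maybe; just; nothing; maybe′; _>>=_)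
import Data.Maybe.Properties as Maybe
open import Data.Nat.Base
  using (ℕ; zero; suc; _+_; _∸_; _≤_; _<_; _≥_; _>_; _≡ᵇ_; z≤n; s≤s; s≤s⁻¹; NonZero)
open import Data.Nat.ListAction using (sum)
import Data.Nat.Properties as ℕ
open import Algebra.Properties.CommutativeSemigroup ℕ.+-commutativeSemigroup
  using () renaming (x∙yz≈y∙xz to +-left-comm; interchange to +-interchange)
open import Data.Product.Base using (_×_; _,_; proj₁; proj₂; ∃-syntax)
open import Data.Product.Properties using () renaming (≡-dec to ×-≡-dec)
open import Data.Sum.Base using (_⊎_; inj₁; inj₂)
open import Data.Vec.Base as Vec using (Vec; []; _∷_)
import Data.Vec.Properties as Vec
open import Data.Vec.Relation.Unary.All as VAll using ([]; _∷_) renaming (All to VAll)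
import Data.Vec.Relation.Unary.Linked as V
open import Data.Vec.Relation.Unary.Linked.Properties using (Linked⇒All)
open import Function.Base using (_∘_; id)
open import Function.Bundles using (module Equivalence)
open import Level using (Level; 0ℓ)
open import Relation.Binary.Core using (Rel; REL)
open import Relation.Binary.Definitions using (Decidable; DecidableEquality; Transitive; tri<; tri≈; tri>)
open import Relation.Binary.PropositionalEquality as ≡ using (_≡_; _≢_; refl)
open import Relation.Nullary using (¬_; Dec; yes; no; does; contradiction)
open import Relation.Nullary.Decidable using (_×-dec_)

-- The operators `t` add the boxes of a strip one at a time, in an order governed by columns, while
-- removing the ones from a tableau deletes all boxes of a strip at once. The bridge is
-- `Interlaced`, a condition on pairs of rows alone: it is what the triple condition demands at the
-- inserted ones, and a word can be rebuilt from it by always bumping the shortest row that still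
-- has to grow. The letter 1, which prepends a part, is treated as the growth of an empty row on
-- top; this is also the only row that a tableau can lose together with its ones. Tableaux are
-- counted for horizontal strips only. Vertical strips enter solely as the signed inverse of the
-- horizontal ones, and s of a column is known only through the relation between the elementary and
-- the complete generators. Elements of NSym are lists with repetitions. Testing them against all
-- functionals turns left multiplication by a generator into composition with a prefix, so that
-- everything becomes an identity between finite sums in the field.

private
  variable
    ℓa ℓb ℓd : Level
    A : Set ℓa
    B : Set ℓb
    D : Set ℓd

-- Finite sums

splits-suc : ∀ n → splits (suc n) ≡ (0 , suc n) ∷ map (λ (i , j) → suc i , j) (splits n)
splits-suc n = ≡.cong ((0 , suc n) ∷_) (≡.trans
  (map-applyUpTo suc (λ i → i , suc n ∸ i) (suc n))
  (≡.sym (≡.trans (≡.cong (map (λ (i , j) → suc i , j)) (map-applyUpTo id (λ i → i , n ∸ i) (suc n)))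
                  (map-applyUpTo (λ i → i , n ∸ i) (λ (i , j) → suc i , j) (suc n)))))

module Sums {c ℓ} (R : CommutativeRing c ℓ) where

  open CommutativeRing R hiding (zero) renaming (_+_ to _⊕_; refl to ≈-refl; sym to ≈-sym; trans to ≈-trans)
  open import Algebra.Properties.CommutativeSemigroup (CommutativeMonoid.commutativeSemigroup +-commutativeMonoid) using (interchange)
  open import Algebra.Definitions.RawSemiring (Semiring.rawSemiring semiring) using (_^_)
  open import Relation.Binary.Reasoning.Setoid setoid

  ∑ᶠ : List A → (A → Carrier) → Carrier
  ∑ᶠ []       f = 0#
  ∑ᶠ (x ∷ xs) f = f x ⊕ ∑ᶠ xs f

  𝟙 : {P : Set ℓa} → Dec P → Carrier
  𝟙 P? = if does P? then 1# else 0#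

  𝟙-yes : {P : Set ℓa} (P? : Dec P) → P → 𝟙 P? ≈ 1#
  𝟙-yes (yes _) p = ≈-refl
  𝟙-yes (no ¬p) p = contradiction p ¬p

  𝟙-no : {P : Set ℓa} (P? : Dec P) → ¬ P → 𝟙 P? ≈ 0#
  𝟙-no (yes p) ¬p = contradiction p ¬p
  𝟙-no (no _)  ¬p = ≈-refl

  𝟙-cong : {P : Set ℓa} {Q : Set ℓb} (P? : Dec P) (Q? : Dec Q) → (P → Q) → (Q → P) → 𝟙 P? ≈ 𝟙 Q?
  𝟙-cong (yes p) Q? f g = ≈-sym (𝟙-yes Q? (f p))
  𝟙-cong (no ¬p) Q? f g = ≈-sym (𝟙-no Q? (¬p ∘ g))

  ∑-cong∈ : ∀ (xs : List A) {f g} → (∀ {x} → x ∈ xs → f x ≈ g x) → ∑ᶠ xs f ≈ ∑ᶠ xs g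
  ∑-cong∈ []       h = ≈-refl
  ∑-cong∈ (x ∷ xs) h = +-cong (h (here refl)) (∑-cong∈ xs (h ∘ there))

  ∑-cong : ∀ (xs : List A) {f g} → (∀ x → f x ≈ g x) → ∑ᶠ xs f ≈ ∑ᶠ xs g
  ∑-cong xs h = ∑-cong∈ xs λ {x} _ → h x

  ∑-0 : ∀ (xs : List A) → ∑ᶠ xs (λ _ → 0#) ≈ 0#
  ∑-0 []       = ≈-refl
  ∑-0 (x ∷ xs) = ≈-trans (+-identityˡ _) (∑-0 xs)

  ∑-zero : ∀ (xs : List A) {f} → (∀ {x} → x ∈ xs → f x ≈ 0#) → ∑ᶠ xs f ≈ 0#
  ∑-zero xs h = ≈-trans (∑-cong∈ xs h) (∑-0 xs)

  ∑-++ : ∀ (xs ys : List A) f → ∑ᶠ (xs ++ ys) f ≈ ∑ᶠ xs f ⊕ ∑ᶠ ys f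
  ∑-++ []       ys f = ≈-sym (+-identityˡ _)
  ∑-++ (x ∷ xs) ys f = ≈-trans (+-congˡ (∑-++ xs ys f)) (≈-sym (+-assoc _ _ _))

  ∑-map : ∀ (h : A → B) xs f → ∑ᶠ (map h xs) f ≈ ∑ᶠ xs (f ∘ h)
  ∑-map h []       f = ≈-refl
  ∑-map h (x ∷ xs) f = +-congˡ (∑-map h xs f)

  ∑-concatMap : ∀ (h : A → List B) xs f → ∑ᶠ (concatMap h xs) f ≈ ∑ᶠ xs (λ x → ∑ᶠ (h x) f)
  ∑-concatMap h []       f = ≈-refl
  ∑-concatMap h (x ∷ xs) f = ≈-trans (∑-++ (h x) _ f) (+-congˡ (∑-concatMap h xs f))

  ∑-cartesianProductWith : ∀ (h : A → B → D) xs ys f →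
    ∑ᶠ (cartesianProductWith h xs ys) f ≈ ∑ᶠ xs (λ x → ∑ᶠ ys (λ y → f (h x y)))
  ∑-cartesianProductWith h []       ys f = ≈-refl
  ∑-cartesianProductWith h (x ∷ xs) ys f = ≈-trans (∑-++ (map (h x) ys) _ f)
    (+-cong (∑-map (h x) ys f) (∑-cartesianProductWith h xs ys f))

  ∑-+ : ∀ (xs : List A) f g → ∑ᶠ xs (λ x → f x ⊕ g x) ≈ ∑ᶠ xs f ⊕ ∑ᶠ xs g
  ∑-+ []       f g = ≈-sym (+-identityˡ _)
  ∑-+ (x ∷ xs) f g = ≈-trans (+-congˡ (∑-+ xs f g)) (interchange _ _ _ _)

  ∑-*ˡ : ∀ k (xs : List A) f → k * ∑ᶠ xs f ≈ ∑ᶠ xs (λ x → k * f x)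
  ∑-*ˡ k []       f = zeroʳ k
  ∑-*ˡ k (x ∷ xs) f = ≈-trans (distribˡ _ _ _) (+-congˡ (∑-*ˡ k xs f))

  ∑-*ʳ : ∀ k (xs : List A) f → ∑ᶠ xs f * k ≈ ∑ᶠ xs (λ x → f x * k)
  ∑-*ʳ k xs f = ≈-trans (*-comm _ _) (≈-trans (∑-*ˡ k xs f) (∑-cong xs λ x → *-comm _ _))

  ∑-swap : ∀ (xs : List A) (ys : List B) (f : A → B → Carrier) →
    ∑ᶠ xs (λ x → ∑ᶠ ys (f x)) ≈ ∑ᶠ ys (λ y → ∑ᶠ xs (λ x → f x y))
  ∑-swap []       ys f = ≈-sym (∑-0 ys)
  ∑-swap (x ∷ xs) ys f = ≈-trans (+-congˡ (∑-swap xs ys f)) (≈-sym (∑-+ ys _ _))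

  ∑-single : ∀ {xs : List A} {x f} → Unique xs → x ∈ xs →
    (∀ {y} → y ∈ xs → y ≢ x → f y ≈ 0#) → ∑ᶠ xs f ≈ f x
  ∑-single {xs = x ∷ xs} (x∉ ∷ u) (here refl) h = ≈-trans
    (+-congˡ (∑-zero xs λ y∈ → h (there y∈) (All.lookup x∉ y∈ ∘ ≡.sym)))
    (+-identityʳ _)
  ∑-single {xs = y ∷ xs} (y∉ ∷ u) (there x∈) h = ≈-trans
    (+-cong (h (here refl) (All.lookup y∉ x∈)) (∑-single u x∈ (h ∘ there)))
    (+-identityˡ _)

  ∑-splits-suc : ∀ n f →
    ∑ᶠ (splits (suc n)) f ≈ f (0 , suc n) ⊕ ∑ᶠ (splits n) (λ (i , j) → f (suc i , j))
  ∑-splits-suc n f = ≈-trans (reflexive (≡.cong (λ xs → ∑ᶠ xs f) (splits-suc n)))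
    (+-congˡ (∑-map (λ (i , j) → suc i , j) (splits n) f))

  ∑-splits-cong : ∀ n {f g} → (∀ i j → i + j ≡ n → f (i , j) ≈ g (i , j)) →
    ∑ᶠ (splits n) f ≈ ∑ᶠ (splits n) g
  ∑-splits-cong zero    h = +-congʳ (h 0 0 refl)
  ∑-splits-cong (suc n) {f} {g} h = begin
    ∑ᶠ (splits (suc n)) f                                  ≈⟨ ∑-splits-suc n f ⟩
    f (0 , suc n) ⊕ ∑ᶠ (splits n) (λ (i , j) → f (suc i , j))
      ≈⟨ +-cong (h 0 (suc n) refl) (∑-splits-cong n λ i j eq → h (suc i) j (≡.cong suc eq)) ⟩
    g (0 , suc n) ⊕ ∑ᶠ (splits n) (λ (i , j) → g (suc i , j)) ≈⟨ ∑-splits-suc n g ⟨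
    ∑ᶠ (splits (suc n)) g                                  ∎

  -- Both sides run over the triples with sum n; the induction on n peels off the triples with i =
  -- 0.
  ∑-splits-assoc : ∀ n (f : ℕ → ℕ → ℕ → Carrier) →
    ∑ᶠ (splits n) (λ (a , k) → ∑ᶠ (splits a) (λ (i , j) → f i j k)) ≈
    ∑ᶠ (splits n) (λ (i , b) → ∑ᶠ (splits b) (λ (j , k) → f i j k))
  ∑-splits-assoc zero    f = ≈-refl
  ∑-splits-assoc (suc n) f = begin
    ∑ᶠ (splits (suc n)) (λ (a , k) → ∑ᶠ (splits a) (λ (i , j) → f i j k))
      ≈⟨ ∑-splits-suc n _ ⟩
    (f 0 0 (suc n) ⊕ 0#) ⊕ ∑ᶠ (splits n) (λ (a , k) → ∑ᶠ (splits (suc a)) (λ (i , j) → f i j k))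
      ≈⟨ +-cong (+-identityʳ _) (∑-cong (splits n) λ (a , k) → ∑-splits-suc a _) ⟩
    f 0 0 (suc n) ⊕ ∑ᶠ (splits n) (λ (a , k) →
      f 0 (suc a) k ⊕ ∑ᶠ (splits a) (λ (i , j) → f (suc i) j k))
      ≈⟨ +-congˡ (∑-+ (splits n) _ _) ⟩
    f 0 0 (suc n) ⊕ (∑ᶠ (splits n) (λ (a , k) → f 0 (suc a) k) ⊕
      ∑ᶠ (splits n) (λ (a , k) → ∑ᶠ (splits a) (λ (i , j) → f (suc i) j k)))
      ≈⟨ +-assoc _ _ _ ⟨
    (f 0 0 (suc n) ⊕ ∑ᶠ (splits n) (λ (a , k) → f 0 (suc a) k)) ⊕
      ∑ᶠ (splits n) (λ (a , k) → ∑ᶠ (splits a) (λ (i , j) → f (suc i) j k))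
      ≈⟨ +-cong (≈-sym (∑-splits-suc n _)) (∑-splits-assoc n (f ∘ suc)) ⟩
    ∑ᶠ (splits (suc n)) (λ (j , k) → f 0 j k) ⊕
      ∑ᶠ (splits n) (λ (i , b) → ∑ᶠ (splits b) (λ (j , k) → f (suc i) j k))
      ≈⟨ ∑-splits-suc n _ ⟨
    ∑ᶠ (splits (suc n)) (λ (i , b) → ∑ᶠ (splits b) (λ (j , k) → f i j k)) ∎

  ∑-splits-sucʳ : ∀ n f →
    ∑ᶠ (splits (suc n)) f ≈ f (suc n , 0) ⊕ ∑ᶠ (splits n) (λ (i , j) → f (i , suc j))
  ∑-splits-sucʳ zero    f = begin
    f (0 , 1) ⊕ (f (1 , 0) ⊕ 0#) ≈⟨ +-assoc _ _ _ ⟨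
    (f (0 , 1) ⊕ f (1 , 0)) ⊕ 0# ≈⟨ +-congʳ (+-comm _ _) ⟩
    (f (1 , 0) ⊕ f (0 , 1)) ⊕ 0# ≈⟨ +-assoc _ _ _ ⟩
    f (1 , 0) ⊕ (f (0 , 1) ⊕ 0#) ∎
  ∑-splits-sucʳ (suc n) f = begin
    ∑ᶠ (splits (suc (suc n))) f
      ≈⟨ ∑-splits-suc (suc n) f ⟩
    f (0 , suc (suc n)) ⊕ ∑ᶠ (splits (suc n)) (λ (i , j) → f (suc i , j))
      ≈⟨ +-congˡ (∑-splits-sucʳ n _) ⟩
    f (0 , suc (suc n)) ⊕ (f (suc (suc n) , 0) ⊕ ∑ᶠ (splits n) (λ (i , j) → f (suc i , suc j)))
      ≈⟨ +-assoc _ _ _ ⟨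
    (f (0 , suc (suc n)) ⊕ f (suc (suc n) , 0)) ⊕ ∑ᶠ (splits n) (λ (i , j) → f (suc i , suc j))
      ≈⟨ +-congʳ (+-comm _ _) ⟩
    (f (suc (suc n) , 0) ⊕ f (0 , suc (suc n))) ⊕ ∑ᶠ (splits n) (λ (i , j) → f (suc i , suc j))
      ≈⟨ +-assoc _ _ _ ⟩
    f (suc (suc n) , 0) ⊕ (f (0 , suc (suc n)) ⊕ ∑ᶠ (splits n) (λ (i , j) → f (suc i , suc j)))
      ≈⟨ +-congˡ (∑-splits-suc n _) ⟨
    f (suc (suc n) , 0) ⊕ ∑ᶠ (splits (suc n)) (λ (i , j) → f (i , suc j)) ∎

  ∑-splits-comm : ∀ n (f : ℕ → ℕ → Carrier) →
    ∑ᶠ (splits n) (λ (i , j) → f i j) ≈ ∑ᶠ (splits n) (λ (i , j) → f j i)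
  ∑-splits-comm zero    f = ≈-refl
  ∑-splits-comm (suc n) f = begin
    ∑ᶠ (splits (suc n)) (λ (i , j) → f i j)                       ≈⟨ ∑-splits-suc n _ ⟩
    f 0 (suc n) ⊕ ∑ᶠ (splits n) (λ (i , j) → f (suc i) j)         ≈⟨ +-congˡ (∑-splits-comm n (f ∘ suc)) ⟩
    f 0 (suc n) ⊕ ∑ᶠ (splits n) (λ (i , j) → f (suc j) i)         ≈⟨ ∑-splits-sucʳ n _ ⟨
    ∑ᶠ (splits (suc n)) (λ (i , j) → f j i)                       ∎

  sgn : ℕ → Carrier
  sgn n = (- 1#) ^ n

  sgn-+ : ∀ m n → sgn (m + n) ≈ sgn m * sgn n
  sgn-+ zero    n = ≈-sym (*-identityˡ _)
  sgn-+ (suc m) n = ≈-trans (*-congˡ (sgn-+ m n)) (≈-sym (*-assoc _ _ _))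

-- Left strips as words

-- Recursive rather than by deciding equality, so that shifting both arguments by one, as in
-- `multiplicity-raise`, holds by computation.
δℕ : ℕ → ℕ → ℕ
δℕ zero    zero    = 1
δℕ zero    (suc j) = 0
δℕ (suc i) zero    = 0
δℕ (suc i) (suc j) = δℕ i j

δℕ-refl : ∀ i → δℕ i i ≡ 1
δℕ-refl zero    = refl
δℕ-refl (suc i) = δℕ-refl i

δℕ-≢ : ∀ {i j} → i ≢ j → δℕ i j ≡ 0
δℕ-≢ {zero}  {zero}  i≢j = contradiction refl i≢j
δℕ-≢ {zero}  {suc j} i≢j = refl
δℕ-≢ {suc i} {zero}  i≢j = refl
δℕ-≢ {suc i} {suc j} i≢j = δℕ-≢ (i≢j ∘ ≡.cong suc)

-- Columns are numbered from 1, as the operators t are.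
inColumn : ℕ → ℕ → ℕ
inColumn zero          n       = 0
inColumn (suc c)       zero    = 0
inColumn (suc zero)    (suc n) = 1
inColumn (suc (suc c)) (suc n) = inColumn (suc c) n

inColumn-suc : ∀ c n → inColumn c (suc n) ≡ δℕ c (suc n) + inColumn c n
inColumn-suc zero          n       = refl
inColumn-suc (suc zero)    zero    = refl
inColumn-suc (suc zero)    (suc n) = refl
inColumn-suc (suc (suc c)) zero    = refl
inColumn-suc (suc (suc c)) (suc n) = inColumn-suc (suc c) n

column : ℕ → Composition → ℕ
column c []      = 0
column c (p ∷ α) = inColumn c (value p) + column c α

occurrences : ∀ {m} → ℕ → Vec ℕ m → ℕ
occurrences c []       = 0
occurrences c (i ∷ is) = δℕ c i + occurrences c is

bumpLeftmost-column : ∀ c k α {β} → bumpLeftmost k α ≡ just β →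
                      column c β ≡ δℕ c (suc k) + column c α
bumpLeftmost-column c k (p ∷ α) eq with value p ≡ᵇ k in p≡k
bumpLeftmost-column c k (p ∷ α) refl | true
  rewrite ℕ.≡ᵇ⇒≡ (value p) k (≡.subst True (≡.sym p≡k) _) =
  ≡.trans (≡.cong (_+ column c α) (inColumn-suc c k)) (ℕ.+-assoc (δℕ c (suc k)) _ _)
bumpLeftmost-column c k (p ∷ α) eq   | false with bumpLeftmost k α in eq′
bumpLeftmost-column c k (p ∷ α) refl | false | just γ =
  ≡.trans (≡.cong (inColumn c (value p) +_) (bumpLeftmost-column c k α eq′))
          (+-left-comm (inColumn c (value p)) (δℕ c (suc k)) (column c α))

t-column : ∀ c i α {β} → t i α ≡ just β → column c β ≡ δℕ c i + column c α
t-column c (suc zero)    α refl =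
  ≡.cong (_+ column c α) (≡.trans (inColumn-suc c 0) (≡.trans (≡.cong (δℕ c 1 +_) (in-0 c)) (ℕ.+-identityʳ _)))
  where
  in-0 : ∀ c → inColumn c 0 ≡ 0
  in-0 zero    = refl
  in-0 (suc c) = refl
t-column c (suc (suc k)) α eq = bumpLeftmost-column c (suc k) α eq

-- `t i` adds a box to column i, whichever row receives it. Hence the multiset of letters of a word
-- can be read off from the two shapes.
t*-column : ∀ {m} c (is : Vec ℕ m) α {β} → t* is α ≡ just β →
            column c β ≡ occurrences c is + column c α
t*-column c []       α refl = refl
t*-column c (i ∷ is) α eq with t i α in eq′
... | just γ = ≡.trans (t*-column c is γ eq) (≡.trans
  (≡.cong (occurrences c is +_) (t-column c i α eq′))
  (≡.trans (+-left-comm (occurrences c is) (δℕ c i) _) (≡.sym (ℕ.+-assoc (δℕ c i) _ _))))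

vectors-unique : ∀ N m → Unique (vectors N m)
vectors-unique N zero    = [] ∷ []
vectors-unique N (suc m) = Unique.cartesianProductWith⁺ _∷_
  (λ eq → Vec.∷-injective eq) (Unique.upTo⁺ N) (vectors-unique N m)

-- The common ground of `_<_`, where antisymmetry is vacuous, and `_≥_`: a linked word is determined
-- by its multiset of letters.
record DecAntisymOrder (_R_ : Rel ℕ 0ℓ) : Set where
  field
    dec     : Decidable _R_
    transᴿ  : Transitive _R_
    antisym : ∀ {i j} → i R j → j R i → i ≡ j

module _ {_R_ : Rel ℕ 0ℓ} (order : DecAntisymOrder _R_) where
  open DecAntisymOrder order

  linked-head : ∀ {m i} {is : Vec ℕ m} → V.Linked _R_ (i ∷ is) → VAll (i R_) is
  linked-head V.[-]           = []
  linked-head (r V.∷ linked)  = Linked⇒All transᴿ r linked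

  linked-tail : ∀ {m i} {is : Vec ℕ m} → V.Linked _R_ (i ∷ is) → V.Linked _R_ is
  linked-tail V.[-]          = V.[]
  linked-tail (_ V.∷ linked) = linked

  occurs-related : ∀ {m i n} c {is : Vec ℕ m} → VAll (i R_) is → occurrences c is ≡ suc n → i R c
  occurs-related c {j ∷ is} (r ∷ rs) eq with c ℕ.≟ j
  ... | yes refl = r
  ... | no c≢j   = occurs-related c rs (≡.trans (≡.sym (≡.cong (_+ occurrences c is) (δℕ-≢ c≢j))) eq)

  -- If the first letters i and j differ, each occurs later in the other word; linkedness then
  -- relates them both ways, against antisymmetry.
  linked-unique : ∀ {m} {is js : Vec ℕ m} → V.Linked _R_ is → V.Linked _R_ js →
                  (∀ c → occurrences c is ≡ occurrences c js) → is ≡ js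
  linked-unique {is = []}     {[]}     _  _   _  = refl
  linked-unique {is = i ∷ is} {j ∷ js} li lj occ with i ℕ.≟ j
  ... | yes refl = ≡.cong (i ∷_) (linked-unique (linked-tail li) (linked-tail lj)
                     λ c → ℕ.+-cancelˡ-≡ (δℕ c i) _ _ (occ c))
  ... | no i≢j   = contradiction (antisym i-R-j j-R-i) i≢j
    where
    j-R-i : j R i
    j-R-i = occurs-related i (linked-head lj) (≡.sym (≡.trans
      (≡.cong (_+ occurrences i is) (≡.sym (δℕ-refl i)))
      (≡.trans (occ i) (≡.cong (_+ occurrences i js) (δℕ-≢ i≢j)))))
    i-R-j : i R j
    i-R-j = occurs-related j (linked-head li) (≡.sym (≡.trans
      (≡.cong (_+ occurrences j js) (≡.sym (δℕ-refl j)))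
      (≡.trans (≡.sym (occ j)) (≡.cong (_+ occurrences j is) (δℕ-≢ (i≢j ∘ ≡.sym))))))

  strip-unique : ∀ {m α β} {is js : Vec ℕ m} → V.Linked _R_ is → V.Linked _R_ js →
                 t* is α ≡ just β → t* js α ≡ just β → is ≡ js
  strip-unique {α = α} {is = is} {js} li lj eq eq′ = linked-unique li lj λ c →
    ℕ.+-cancelʳ-≡ (column c α) _ _ (≡.trans (≡.sym (t*-column c is α eq)) (t*-column c js α eq′))

strictOrder : DecAntisymOrder _<_
strictOrder = record
  { dec = ℕ._<?_ ; transᴿ = ℕ.<-trans ; antisym = λ i<j j<i → contradiction j<i (ℕ.<-asym i<j) }

weakOrder : DecAntisymOrder _≥_
weakOrder = record
  { dec = ℕ._≥?_ ; transᴿ = λ i≥j j≥k → ℕ.≤-trans j≥k i≥j ; antisym = λ i≥j j≥i → ℕ.≤-antisym j≥i i≥j }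

-- Alternating sums over words of operators

module StripSums {c ℓ} (K : CommutativeRing c ℓ) where

  open CommutativeRing K hiding (zero) renaming (_+_ to _⊕_; refl to ≈-refl; sym to ≈-sym; trans to ≈-trans)
  open Sums K
  open import Algebra.Properties.CommutativeSemigroup (CommutativeMonoid.commutativeSemigroup *-commutativeMonoid)
    using () renaming (x∙yz≈y∙xz to *-left-comm)
  open import Algebra.Properties.Ring ring using (-1*x≈-x)
  open import Relation.Binary.Reasoning.Setoid setoid

  lift : (Composition → Carrier) → Maybe Composition → Carrier
  lift g = maybe′ g 0#

  -- N bounds the alphabet to keep the sums finite; `∑-from` takes it large enough to lose no strip.
  -- The letter 0 contributes nothing, since `t 0` is the formal zero.
  module Words (N : ℕ) {_R_ : Rel ℕ 0ℓ} (R? : Decidable _R_) where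

    wordSum : ∀ m → (Composition → Carrier) → Composition → Carrier
    wordSum m g α = ∑ᶠ (vectors N m) λ is → 𝟙 (V.linked? R? is) * lift g (t* is α)

    -- Remembers the preceding letter i, which is what a recursion on the first letter of a linked
    -- word needs.
    wordSumAfter : ℕ → ∀ m → (Composition → Carrier) → Composition → Carrier
    wordSumAfter i m g α = ∑ᶠ (vectors N m) λ is → 𝟙 (V.linked? R? (i ∷ is)) * lift g (t* is α)

    wordSum-zero : ∀ g α → wordSum 0 g α ≈ g α
    wordSum-zero g α = ≈-trans (+-identityʳ _) (*-identityˡ _)

    wordSumAfter-zero : ∀ i g α → wordSumAfter i 0 g α ≈ g α
    wordSumAfter-zero i g α = ≈-trans (+-identityʳ _) (*-identityˡ _)

    lift-after : ∀ k m g α →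
      ∑ᶠ (vectors N m) (λ is → 𝟙 (V.linked? R? (k ∷ is)) * lift g (t* (k ∷ is) α)) ≈
      lift (wordSumAfter k m g) (t k α)
    lift-after k m g α with t k α
    ... | just γ  = ≈-refl
    ... | nothing = ∑-zero (vectors N m) λ _ → zeroʳ _

    wordSum-suc : ∀ m g α →
      wordSum (suc m) g α ≈ ∑ᶠ (upTo N) λ k → lift (wordSumAfter k m g) (t k α)
    wordSum-suc m g α = ≈-trans (∑-cartesianProductWith _∷_ (upTo N) (vectors N m) _)
      (∑-cong (upTo N) λ k → lift-after k m g α)

    𝟙-linked : ∀ {m} i k (is : Vec ℕ m) →
      𝟙 (V.linked? R? (i ∷ k ∷ is)) ≈ 𝟙 (R? i k) * 𝟙 (V.linked? R? (k ∷ is))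
    𝟙-linked i k is with R? i k | V.linked? R? (k ∷ is)
    ... | yes _ | yes _ = ≈-sym (*-identityˡ _)
    ... | yes _ | no _  = ≈-sym (*-identityˡ _)
    ... | no _  | yes _ = ≈-sym (zeroˡ _)
    ... | no _  | no _  = ≈-sym (zeroˡ _)

    wordSumAfter-suc : ∀ i m g α → wordSumAfter i (suc m) g α ≈
      ∑ᶠ (upTo N) λ k → 𝟙 (R? i k) * lift (wordSumAfter k m g) (t k α)
    wordSumAfter-suc i m g α = ≈-trans (∑-cartesianProductWith _∷_ (upTo N) (vectors N m) _)
      (∑-cong (upTo N) λ k → ≈-trans
        (∑-cong (vectors N m) λ is → ≈-trans (*-congʳ (𝟙-linked i k is)) (*-assoc _ _ _))
        (≈-trans (≈-sym (∑-*ˡ _ (vectors N m) _)) (*-congˡ (lift-after k m g α))))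

  open Words

  -- With r and s the indicators of complementary relations, the part of the first summand selected
  -- by r cancels the second summand.
  sgn-cancel : ∀ {r s x} m → r ⊕ s ≈ 1# → sgn (suc m) * x ⊕ r * (sgn m * x) ≈ sgn (suc m) * (s * x)
  sgn-cancel {r} {s} {x} m r+s≈1 = begin
    sgn (suc m) * x ⊕ r * (sgn m * x)
      ≈⟨ +-congʳ (≈-trans (*-congˡ (≈-sym (≈-trans (*-congʳ r+s≈1) (*-identityˡ x))))
                          (≈-trans (*-congˡ (distribʳ x r s)) (distribˡ _ _ _))) ⟩
    (sgn (suc m) * (r * x) ⊕ sgn (suc m) * (s * x)) ⊕ r * (sgn m * x)
      ≈⟨ +-congˡ (*-left-comm r (sgn m) x) ⟩
    (sgn (suc m) * (r * x) ⊕ sgn (suc m) * (s * x)) ⊕ sgn m * (r * x)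
      ≈⟨ +-congʳ (+-comm _ _) ⟩
    (sgn (suc m) * (s * x) ⊕ sgn (suc m) * (r * x)) ⊕ sgn m * (r * x)
      ≈⟨ +-assoc _ _ _ ⟩
    sgn (suc m) * (s * x) ⊕ (sgn (suc m) * (r * x) ⊕ sgn m * (r * x))
      ≈⟨ +-congˡ (+-congʳ (≈-trans (*-assoc _ _ _) (-1*x≈-x _))) ⟩
    sgn (suc m) * (s * x) ⊕ (- (sgn m * (r * x)) ⊕ sgn m * (r * x))
      ≈⟨ +-congˡ (-‿inverseˡ _) ⟩
    sgn (suc m) * (s * x) ⊕ 0#
      ≈⟨ +-identityʳ _ ⟩
    sgn (suc m) * (s * x) ∎

  -- The coefficients of the constant power series 1.
  δ₀ : ℕ → Carrier
  δ₀ zero    = 1#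
  δ₀ (suc _) = 0#

  module _ {_R_ _S_ : Rel ℕ 0ℓ} (R? : Decidable _R_) (S? : Decidable _S_)
           (complementary : ∀ i k → 𝟙 (R? i k) ⊕ 𝟙 (S? i k) ≈ 1#) (N : ℕ) where

    -- When the first block is empty, the first letter k of the second block is unrestricted by i.
    -- The words with i R k cancel against those whose first block starts with k, which leaves the
    -- words linked by S throughout, including the link from i to k.
    wordSums-inverseAfter : ∀ i m f α →
      ∑ᶠ (splits m) (λ (a , j) → sgn j * wordSumAfter N R? i a (wordSum N S? j f) α) ≈
      sgn m * wordSumAfter N S? i m f α
    lift-inverseAfter : ∀ k m f mα →
      ∑ᶠ (splits m) (λ (a , j) → sgn j * lift (wordSumAfter N R? k a (wordSum N S? j f)) mα) ≈
      sgn m * lift (wordSumAfter N S? k m f) mα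
    lift-inverseAfter k m f (just γ) = wordSums-inverseAfter k m f γ
    lift-inverseAfter k m f nothing  =
      ≈-trans (∑-zero (splits m) λ _ → zeroʳ _) (≈-sym (zeroʳ _))

    wordSums-inverseAfter i zero f α = ≈-trans (+-identityʳ _) (*-congˡ (≈-trans
      (wordSumAfter-zero N R? i (wordSum N S? 0 f) α)
      (≈-trans (wordSum-zero N S? f α) (≈-sym (wordSumAfter-zero N S? i f α)))))
    wordSums-inverseAfter i (suc m) f α = begin
      ∑ᶠ (splits (suc m)) (λ (a , j) → sgn j * wordSumAfter N R? i a (wordSum N S? j f) α)
        ≈⟨ ∑-splits-suc m _ ⟩
      sgn (suc m) * wordSumAfter N R? i 0 (wordSum N S? (suc m) f) α ⊕
        ∑ᶠ (splits m) (λ (a , j) → sgn j * wordSumAfter N R? i (suc a) (wordSum N S? j f) α)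
        ≈⟨ +-cong
             (≈-trans (*-congˡ (≈-trans (wordSumAfter-zero N R? i (wordSum N S? (suc m) f) α) (wordSum-suc N S? m f α)))
                      (∑-*ˡ _ (upTo N) _))
             (≈-trans (∑-cong (splits m) λ (a , j) → ≈-trans
                        (*-congˡ (wordSumAfter-suc N R? i a _ α))
                        (≈-trans (∑-*ˡ _ (upTo N) _) (∑-cong (upTo N) λ k → *-left-comm _ _ _)))
                      (≈-trans (∑-swap (splits m) (upTo N) _)
                               (∑-cong (upTo N) λ k → ≈-trans (≈-sym (∑-*ˡ _ (splits m) _))
                                 (*-congˡ (lift-inverseAfter k m f (t k α)))))) ⟩
      ∑ᶠ (upTo N) (λ k → sgn (suc m) * X k) ⊕ ∑ᶠ (upTo N) (λ k → 𝟙 (R? i k) * (sgn m * X k))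
        ≈⟨ ∑-+ (upTo N) _ _ ⟨
      ∑ᶠ (upTo N) (λ k → sgn (suc m) * X k ⊕ 𝟙 (R? i k) * (sgn m * X k))
        ≈⟨ ∑-cong (upTo N) (λ k → sgn-cancel m (complementary i k)) ⟩
      ∑ᶠ (upTo N) (λ k → sgn (suc m) * (𝟙 (S? i k) * X k))
        ≈⟨ ∑-*ˡ _ (upTo N) _ ⟨
      sgn (suc m) * ∑ᶠ (upTo N) (λ k → 𝟙 (S? i k) * X k)
        ≈⟨ *-congˡ (wordSumAfter-suc N S? i m f α) ⟨
      sgn (suc m) * wordSumAfter N S? i (suc m) f α ∎
      where
      X : ℕ → Carrier
      X k = lift (wordSumAfter N S? k m f) (t k α)

    -- Moving the letter at the boundary of the two subwords is a
    -- sign-reversing involution.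
    wordSums-inverse : ∀ m f α →
      ∑ᶠ (splits m) (λ (a , j) → sgn j * wordSum N R? a (wordSum N S? j f) α) ≈ δ₀ m * f α
    wordSums-inverse zero f α = ≈-trans (+-identityʳ _) (*-congˡ (≈-trans
      (wordSum-zero N R? (wordSum N S? 0 f) α) (wordSum-zero N S? f α)))
    wordSums-inverse (suc m) f α = begin
      ∑ᶠ (splits (suc m)) (λ (a , j) → sgn j * wordSum N R? a (wordSum N S? j f) α)
        ≈⟨ ∑-splits-suc m _ ⟩
      sgn (suc m) * wordSum N R? 0 (wordSum N S? (suc m) f) α ⊕
        ∑ᶠ (splits m) (λ (a , j) → sgn j * wordSum N R? (suc a) (wordSum N S? j f) α)
        ≈⟨ +-cong
             (≈-trans (*-congˡ (≈-trans (wordSum-zero N R? (wordSum N S? (suc m) f) α) (wordSum-suc N S? m f α)))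
                      (∑-*ˡ _ (upTo N) _))
             (≈-trans (∑-cong (splits m) λ (a , j) → ≈-trans
                        (*-congˡ (wordSum-suc N R? a _ α)) (∑-*ˡ _ (upTo N) _))
                      (≈-trans (∑-swap (splits m) (upTo N) _) (∑-cong (upTo N) λ k →
                        lift-inverseAfter k m f (t k α)))) ⟩
      ∑ᶠ (upTo N) (λ k → sgn (suc m) * X k) ⊕ ∑ᶠ (upTo N) (λ k → sgn m * X k)
        ≈⟨ ∑-+ (upTo N) _ _ ⟨
      ∑ᶠ (upTo N) (λ k → sgn (suc m) * X k ⊕ sgn m * X k)
        ≈⟨ ∑-zero (upTo N) (λ {k} _ → ≈-trans
             (+-congʳ (≈-trans (*-assoc _ _ _) (-1*x≈-x _))) (-‿inverseˡ _)) ⟩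
      0#         ≈⟨ zeroˡ _ ⟨
      0# * f α   ∎
      where
      X : ℕ → Carrier
      X k = lift (wordSumAfter N S? k m f) (t k α)

-- Sums over strips and their inversion

module _ {_R_ : Rel ℕ 0ℓ} (order : DecAntisymOrder _R_) where
  open DecAntisymOrder order

  from⇒Strip : ∀ {m α β} → β ∈ stripsFrom dec m α → Strip _R_ m α β
  from⇒Strip {m} {α} {β} = Equivalence.to (∈-stripsFrom dec m α β)

  Strip⇒from : ∀ {m α β} → Strip _R_ m α β → β ∈ stripsFrom dec m α
  Strip⇒from {m} {α} {β} = Equivalence.from (∈-stripsFrom dec m α β)

  to⇒Strip : ∀ {m α β} → α ∈ stripsTo dec m β → Strip _R_ m α β
  to⇒Strip {m} {α} {β} = Equivalence.to (∈-stripsTo dec m α β)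

  Strip⇒to : ∀ {m α β} → Strip _R_ m α β → α ∈ stripsTo dec m β
  Strip⇒to {m} {α} {β} = Equivalence.from (∈-stripsTo dec m α β)

Strip-size : ∀ {_R_ : Rel ℕ 0ℓ} {m α β} → Strip _R_ m α β → size β ≡ size α + m
Strip-size {α = α} (is , _ , eq) = proj₁ (t*-size is α eq)

-- A finite index set for the matrices given by strips; `deduplicate` yields uniqueness without
-- comparing compositions of different sizes.
compositionsUpTo : ℕ → List Composition
compositionsUpTo n = deduplicate _≟_ (concatMap compositions (upTo (suc n)))

compositionsUpTo-unique : ∀ n → Unique (compositionsUpTo n)
compositionsUpTo-unique n = deduplicate-! _≟_ (concatMap compositions (upTo (suc n)))

∈-compositionsUpTo : ∀ {n} α → size α ≤ n → α ∈ compositionsUpTo n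
∈-compositionsUpTo α sz≤n = ∈-deduplicate⁺ _≟_
  (∈-concatMap⁺ compositions (lose (∈-upTo⁺ (s≤s sz≤n)) (∈-compositions α refl)))

module StripInversion {c ℓ} (K : CommutativeRing c ℓ) where

  open CommutativeRing K hiding (zero) renaming (_+_ to _⊕_; refl to ≈-refl; sym to ≈-sym; trans to ≈-trans)
  open Sums K
  open StripSums K
  open Words
  open import Algebra.Properties.CommutativeSemigroup (CommutativeMonoid.commutativeSemigroup *-commutativeMonoid)
    using () renaming (x∙yz≈y∙xz to *-left-comm)
  open import Relation.Binary.Reasoning.Setoid setoid

  ∑-select : ∀ (_≟ᴬ_ : DecidableEquality A) {xs x} (f : A → Carrier) →
    Unique xs → x ∈ xs → ∑ᶠ xs (λ y → 𝟙 (y ≟ᴬ x) * f y) ≈ f x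
  ∑-select _≟ᴬ_ {x = x} f u x∈ = ≈-trans
    (∑-single u x∈ λ {y} _ y≢x → ≈-trans (*-congʳ (𝟙-no (y ≟ᴬ x) y≢x)) (zeroˡ _))
    (≈-trans (*-congʳ (𝟙-yes (x ≟ᴬ x) refl)) (*-identityˡ _))

  module _ {_R_ : Rel ℕ 0ℓ} (order : DecAntisymOrder _R_) where
    open DecAntisymOrder order

    private
      from to : ℕ → Composition → List Composition
      from = stripsFrom dec
      to   = stripsTo dec

    -- Each β is reached by exactly one linked word, by `strip-unique`, so the pairs of a β and its
    -- word are summed in either order. The bound on N keeps that word within the alphabet.
    ∑-from : ∀ {N m} α g → size α + m < N → ∑ᶠ (from m α) g ≈ wordSum N dec m g α
    ∑-from {N} {m} α g sz<N = begin
      ∑ᶠ (from m α) g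
        ≈⟨ ∑-cong∈ (from m α) expand ⟩
      ∑ᶠ (from m α) (λ β → ∑ᶠ (vectors N m) (λ is → 𝟙 (V.linked? dec is) * F is β))
        ≈⟨ ∑-swap (from m α) (vectors N m) _ ⟩
      ∑ᶠ (vectors N m) (λ is → ∑ᶠ (from m α) (λ β → 𝟙 (V.linked? dec is) * F is β))
        ≈⟨ ∑-cong (vectors N m) collapse ⟩
      wordSum N dec m g α ∎
      where
      F : Vec ℕ m → Composition → Carrier
      F is β = 𝟙 (Maybe.≡-dec _≟_ (t* is α) (just β)) * g β

      expand : ∀ {β} → β ∈ from m α → g β ≈ ∑ᶠ (vectors N m) (λ is → 𝟙 (V.linked? dec is) * F is β)
      expand {β} β∈ with from⇒Strip order β∈
      ... | is , linked , eq = ≈-sym (≈-trans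
        (∑-single (vectors-unique N m)
          (∈-vectors (VAll.map (λ i< → ℕ.≤-trans i< (≡.subst (_< N) (≡.sym sz) sz<N)) (proj₂ (t*-size is α eq))))
          vanish)
        (≈-trans (*-cong (𝟙-yes (V.linked? dec is) linked)
                         (≈-trans (*-congʳ (𝟙-yes (Maybe.≡-dec _≟_ (t* is α) (just β)) eq)) (*-identityˡ _)))
                 (*-identityˡ _)))
        where
        sz : size β ≡ size α + m
        sz = proj₁ (t*-size is α eq)
        vanish : ∀ {js} → js ∈ vectors N m → js ≢ is → 𝟙 (V.linked? dec js) * F js β ≈ 0#
        vanish {js} _ js≢is with V.linked? dec js | Maybe.≡-dec _≟_ (t* js α) (just β)
        ... | yes lj | yes eq′ = contradiction (strip-unique order lj linked eq′ eq) js≢is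
        ... | yes _  | no _    = ≈-trans (*-identityˡ _) (zeroˡ _)
        ... | no _   | _       = zeroˡ _

      collapse : ∀ is → ∑ᶠ (from m α) (λ β → 𝟙 (V.linked? dec is) * F is β) ≈
                        𝟙 (V.linked? dec is) * lift g (t* is α)
      collapse is with V.linked? dec is
      ... | no _ = ≈-trans (∑-zero (from m α) λ _ → zeroˡ _) (≈-sym (zeroˡ _))
      ... | yes linked with t* is α in eq
      ...   | nothing = ≈-trans (∑-zero (from m α) λ _ → ≈-trans (*-identityˡ _) (zeroˡ _)) (≈-sym (zeroʳ _))
      ...   | just γ  = ≈-trans
        (∑-single (stripsFrom-unique dec m α) (Strip⇒from order (is , linked , eq))
          λ {β} _ β≢γ → ≈-trans (*-identityˡ _) (≈-trans
            (*-congʳ (𝟙-no (Maybe.≡-dec _≟_ (just γ) (just β)) (β≢γ ∘ ≡.sym ∘ Maybe.just-injective))) (zeroˡ _)))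
        (*-congˡ (≈-trans (*-congʳ (𝟙-yes (Maybe.≡-dec _≟_ (just γ) (just γ)) refl)) (*-identityˡ _)))

    -- The strips of size m form a matrix of zeros and ones; its entry at α and β is read once along
    -- the row and once along the column.
    ∑-from-to : ∀ m α β → ∑ᶠ (from m α) (λ γ → 𝟙 (γ ≟ β)) ≈ ∑ᶠ (to m β) (λ γ → 𝟙 (γ ≟ α))
    ∑-from-to m α β with strip? dec m α β
    ... | yes s = ≈-trans (one (stripsFrom-unique dec m α) (Strip⇒from order s))
                          (≈-sym (one (stripsTo-unique dec m β) (Strip⇒to order s)))
      where
      one : ∀ {xs x} → Unique xs → x ∈ xs → ∑ᶠ xs (λ y → 𝟙 (y ≟ x)) ≈ 1#
      one {x = x} u x∈ = ≈-trans (∑-single u x∈ λ {y} _ y≢x → 𝟙-no (y ≟ x) y≢x) (𝟙-yes (x ≟ x) refl)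
    ... | no ¬s = ≈-trans
      (∑-zero (from m α) λ {γ} γ∈ → 𝟙-no (γ ≟ β) λ { refl → ¬s (from⇒Strip order γ∈) })
      (≈-sym (∑-zero (to m β) λ {γ} γ∈ → 𝟙-no (γ ≟ α) λ { refl → ¬s (to⇒Strip order γ∈) }))

    ∑-to : ∀ {n} m β f → size β ≤ n → ∑ᶠ (to m β) f ≈
      ∑ᶠ (compositionsUpTo n) (λ α → f α * ∑ᶠ (from m α) (λ γ → 𝟙 (γ ≟ β)))
    ∑-to {n} m β f sz≤n = begin
      ∑ᶠ (to m β) f
        ≈⟨ ∑-cong∈ (to m β) (λ {γ} γ∈ → ≈-sym (∑-select _≟_ f (compositionsUpTo-unique n)
             (∈-compositionsUpTo γ (ℕ.≤-trans (≡.subst (size γ ≤_)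
               (≡.sym (Strip-size (to⇒Strip order γ∈))) (ℕ.m≤m+n (size γ) m)) sz≤n)))) ⟩
      ∑ᶠ (to m β) (λ γ → ∑ᶠ (compositionsUpTo n) (λ α → 𝟙 (α ≟ γ) * f α))
        ≈⟨ ∑-swap (to m β) (compositionsUpTo n) _ ⟩
      ∑ᶠ (compositionsUpTo n) (λ α → ∑ᶠ (to m β) (λ γ → 𝟙 (α ≟ γ) * f α))
        ≈⟨ ∑-cong (compositionsUpTo n) (λ α → ≈-trans (≈-sym (∑-*ʳ (f α) (to m β) _)) (≈-trans (*-comm _ _)
             (*-congˡ (≈-trans (∑-cong (to m β) λ γ → 𝟙-cong (α ≟ γ) (γ ≟ α) ≡.sym ≡.sym) (≈-sym (∑-from-to m α β)))))) ⟩
      ∑ᶠ (compositionsUpTo n) (λ α → f α * ∑ᶠ (from m α) (λ γ → 𝟙 (γ ≟ β))) ∎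

  module _ {_R_ _S_ : Rel ℕ 0ℓ} (r : DecAntisymOrder _R_) (s : DecAntisymOrder _S_)
           (R⇒¬S : ∀ {i k} → i R k → ¬ i S k) (¬R⇒S : ∀ {i k} → ¬ i R k → i S k) where
    open DecAntisymOrder r renaming (dec to R?) using ()
    open DecAntisymOrder s renaming (dec to S?) using ()

    complementary : ∀ i k → 𝟙 (R? i k) ⊕ 𝟙 (S? i k) ≈ 1#
    complementary i k with R? i k
    ... | yes p = ≈-trans (+-congˡ (𝟙-no (S? i k) (R⇒¬S p))) (+-identityʳ _)
    ... | no ¬p = ≈-trans (+-congˡ (𝟙-yes (S? i k) (¬R⇒S ¬p))) (+-identityˡ _)

    from-inverse : ∀ m f α →
      ∑ᶠ (splits m) (λ (a , j) → sgn j *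
        ∑ᶠ (stripsFrom R? a α) (λ ρ → ∑ᶠ (stripsFrom S? j ρ) f)) ≈ δ₀ m * f α
    from-inverse m f α = ≈-trans
      (∑-splits-cong m λ a j a+j≡m → *-congˡ (≈-trans
        (∑-cong∈ (stripsFrom R? a α) λ {ρ} ρ∈ → ∑-from s ρ f
          (s≤s (ℕ.≤-reflexive (≡.trans (≡.cong (_+ j) (Strip-size (from⇒Strip r {a} {α} ρ∈)))
            (≡.trans (ℕ.+-assoc (size α) a j) (≡.cong (size α +_) a+j≡m))))))
        (∑-from r α _ (s≤s (ℕ.+-monoʳ-≤ (size α) (ℕ.≤-trans (ℕ.m≤m+n a j) (ℕ.≤-reflexive a+j≡m)))))))
      (wordSums-inverse R? S? complementary (suc (size α + m)) m f α)

    -- Transposition of `from-inverse`: the signed sum of matrix products acts on functions of the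
    -- source instead of the target, and an identity matrix is its own transpose.
    to-inverse : ∀ m f β →
      ∑ᶠ (splits m) (λ (a , j) → sgn j *
        ∑ᶠ (stripsTo S? j β) (λ ρ → ∑ᶠ (stripsTo R? a ρ) f)) ≈ δ₀ m * f β
    to-inverse m f β = begin
      ∑ᶠ (splits m) (λ (a , j) → sgn j * ∑ᶠ (stripsTo S? j β) (λ ρ → ∑ᶠ (stripsTo R? a ρ) f))
        ≈⟨ ∑-cong (splits m) (λ (a , j) → *-congˡ (transpose a j)) ⟩
      ∑ᶠ (splits m) (λ (a , j) → sgn j * ∑ᶠ C (λ α → f α * twoStep a j α))
        ≈⟨ ∑-cong (splits m) (λ (a , j) → ≈-trans (∑-*ˡ _ C _) (∑-cong C λ α → *-left-comm _ _ _)) ⟩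
      ∑ᶠ (splits m) (λ (a , j) → ∑ᶠ C (λ α → f α * (sgn j * twoStep a j α)))
        ≈⟨ ∑-swap (splits m) C _ ⟩
      ∑ᶠ C (λ α → ∑ᶠ (splits m) (λ (a , j) → f α * (sgn j * twoStep a j α)))
        ≈⟨ ∑-cong C (λ α → ≈-trans (≈-sym (∑-*ˡ _ (splits m) _)) (*-congˡ (from-inverse m _ α))) ⟩
      ∑ᶠ C (λ α → f α * (δ₀ m * 𝟙 (α ≟ β)))
        ≈⟨ ∑-cong C (λ α → ≈-trans (*-left-comm _ _ _) (*-congˡ (*-comm _ _))) ⟩
      ∑ᶠ C (λ α → δ₀ m * (𝟙 (α ≟ β) * f α))
        ≈⟨ ∑-*ˡ _ C _ ⟨
      δ₀ m * ∑ᶠ C (λ α → 𝟙 (α ≟ β) * f α)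
        ≈⟨ *-congˡ (∑-select _≟_ f (compositionsUpTo-unique (size β)) (∈-compositionsUpTo β ℕ.≤-refl)) ⟩
      δ₀ m * f β ∎
      where
      C : List Composition
      C = compositionsUpTo (size β)

      twoStep : ℕ → ℕ → Composition → Carrier
      twoStep a j α = ∑ᶠ (stripsFrom R? a α) (λ ρ → ∑ᶠ (stripsFrom S? j ρ) (λ γ → 𝟙 (γ ≟ β)))

      transpose : ∀ a j → ∑ᶠ (stripsTo S? j β) (λ ρ → ∑ᶠ (stripsTo R? a ρ) f) ≈
                          ∑ᶠ C (λ α → f α * twoStep a j α)
      transpose a j = begin
        ∑ᶠ (stripsTo S? j β) (λ ρ → ∑ᶠ (stripsTo R? a ρ) f)
          ≈⟨ ∑-cong∈ (stripsTo S? j β) (λ {ρ} ρ∈ → ∑-to r a ρ f (≡.subst (size ρ ≤_)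
               (≡.sym (Strip-size (to⇒Strip s ρ∈))) (ℕ.m≤m+n (size ρ) j))) ⟩
        ∑ᶠ (stripsTo S? j β) (λ ρ → ∑ᶠ C (λ α → f α * ∑ᶠ (stripsFrom R? a α) (λ γ → 𝟙 (γ ≟ ρ))))
          ≈⟨ ∑-swap (stripsTo S? j β) C _ ⟩
        ∑ᶠ C (λ α → ∑ᶠ (stripsTo S? j β) (λ ρ → f α * ∑ᶠ (stripsFrom R? a α) (λ γ → 𝟙 (γ ≟ ρ))))
          ≈⟨ ∑-cong C (λ α → ≈-trans (≈-sym (∑-*ˡ _ (stripsTo S? j β) _)) (*-congˡ (≈-trans
               (∑-swap (stripsTo S? j β) (stripsFrom R? a α) _)
               (∑-cong (stripsFrom R? a α) λ γ → ≈-trans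
                 (∑-cong (stripsTo S? j β) λ ρ → 𝟙-cong (γ ≟ ρ) (ρ ≟ γ) ≡.sym ≡.sym)
                 (≈-sym (∑-from-to s j γ β)))))) ⟩
        ∑ᶠ C (λ α → f α * twoStep a j α) ∎

-- Left strips as pairs of sequences of row lengths

data Bump (k : ℕ) : List ℕ → List ℕ → Set where
  here  : ∀ {as} → Bump k (k ∷ as) (suc k ∷ as)
  there : ∀ {a as bs} → a ≢ k → Bump k as bs → Bump k (a ∷ as) (a ∷ bs)

-- k is the length of the bumped part, one less than the index of the
-- corresponding operator t.
data Bumps (i : ℕ) : ℕ → List ℕ → List ℕ → Set where
  done : ∀ {as} → Bumps i 0 as as
  step : ∀ {k n as bs cs} → i ≤ k → Bump k as bs → Bumps (suc k) n bs cs → Bumps i (suc n) as cs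

bumpLeftmost⇒Bump : ∀ k α {β} → bumpLeftmost k α ≡ just β → Bump k (parts α) (parts β)
bumpLeftmost⇒Bump k (p ∷ α) eq with value p ≡ᵇ k in p≡k
bumpLeftmost⇒Bump k (p ∷ α) refl | true
  rewrite ℕ.≡ᵇ⇒≡ (value p) k (≡.subst True (≡.sym p≡k) _) = here
bumpLeftmost⇒Bump k (p ∷ α) eq   | false with bumpLeftmost k α in eq′
bumpLeftmost⇒Bump k (p ∷ α) refl | false | just γ = there
  (λ p≡k′ → ≡.subst True p≡k (ℕ.≡⇒≡ᵇ (value p) k p≡k′))
  (bumpLeftmost⇒Bump k α eq′)

Bump⇒bumpLeftmost : ∀ k α {bs} → Bump k (parts α) bs → ∃[ β ] bumpLeftmost k α ≡ just β × parts β ≡ bs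
Bump⇒bumpLeftmost k (p ∷ α) b with value p ≡ᵇ k in p≡k
Bump⇒bumpLeftmost k (p ∷ α) here          | true  = _ , refl , refl
Bump⇒bumpLeftmost k (p ∷ α) (there p≢k _) | true  =
  contradiction (ℕ.≡ᵇ⇒≡ (value p) k (≡.subst True (≡.sym p≡k) _)) p≢k
Bump⇒bumpLeftmost k (p ∷ α) here          | false =
  contradiction (ℕ.≡⇒≡ᵇ k k refl) (≡.subst True p≡k)
Bump⇒bumpLeftmost k (p ∷ α) (there _ b)   | false with bumpLeftmost k α | Bump⇒bumpLeftmost k α b
... | just _ | γ , refl , refl = p ∷ γ , refl , refl

t*⇒Bumps : ∀ {n i} (is : Vec ℕ n) α {β} → V.Linked _<_ (suc i ∷ is) → t* is α ≡ just β →
           Bumps (suc i) n (parts α) (parts β)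
t*⇒Bumps []                 α _               refl = done
t*⇒Bumps (suc zero ∷ is)    α (s≤s () V.∷ _)  eq
t*⇒Bumps (suc (suc k) ∷ is) α (s≤s i<k V.∷ l) eq with bumpLeftmost (suc k) α in eq′
... | just γ = step i<k (bumpLeftmost⇒Bump (suc k) α eq′) (t*⇒Bumps is γ l eq)

parts-inj : ∀ {α β} → parts α ≡ parts β → α ≡ β
parts-inj = map-injective λ { refl → refl }

Bumps⇒t* : ∀ {n i} α β → Bumps (suc i) n (parts α) (parts β) →
           ∃[ is ] V.Linked _<_ (suc i ∷ is) × t* {n} is α ≡ just β
Bumps⇒t* α β b = go α b refl
  where
  go : ∀ {n i bs} α → Bumps (suc i) n (parts α) bs → bs ≡ parts β →
       ∃[ is ] V.Linked _<_ (suc i ∷ is) × t* {n} is α ≡ just β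
  go α done eq = [] , V.[-] , ≡.cong just (parts-inj eq)
  go α (step {suc k} i<k b bs) eq with Bump⇒bumpLeftmost (suc k) α b
  ... | γ , eq′ , refl with go γ bs eq
  ...   | is , linked , eq″ =
    suc (suc k) ∷ is , s≤s i<k V.∷ linked , ≡.trans (≡.cong (λ m → m >>= t* is) eq′) eq″

-- Every bump acts on a length at least i, which exceeds a, so the first row is never chosen.
first-stays : ∀ {i n a as bs} → a < i → Bumps i n (a ∷ as) bs → ∃[ cs ] a ∷ cs ≡ bs
first-stays a<i done                      = _ , refl
first-stays a<i (step i≤k here _)         = contradiction a<i (ℕ.≤⇒≯ i≤k)
first-stays a<i (step i≤k (there _ _) bs) = first-stays (ℕ.m≤n⇒m≤1+n (ℕ.≤-trans a<i i≤k)) bs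

0∷≢parts : ∀ {as} β → 0 ∷ as ≢ parts β
0∷≢parts (part (suc _) ∷ β) ()

-- `t 1` amounts to bumping an empty row placed on top. In an increasing word the letter 1 can only
-- come first, whence the two alternatives.
LH⇒Bumps : ∀ {n α β} → α ⟶LH[ n ] β →
           Bumps 1 n (parts α) (parts β) ⊎ Bumps 0 n (0 ∷ parts α) (parts β)
LH⇒Bumps                 ([]                 , _ , refl)   = inj₁ done
LH⇒Bumps {α = α} (suc zero ∷ is     , linked , eq) = inj₂ (step z≤n here (t*⇒Bumps is (1ᵖ ∷ α) linked eq))
LH⇒Bumps {α = α} (suc (suc k) ∷ is , linked , eq) =
  inj₁ (t*⇒Bumps (suc (suc k) ∷ is) α (s≤s (s≤s z≤n) V.∷ linked) eq)

Bumps₁⇒LH : ∀ {n} α β → Bumps 1 n (parts α) (parts β) → α ⟶LH[ n ] β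
Bumps₁⇒LH α β b with Bumps⇒t* α β b
... | is , linked , eq = is , linked-tail strictOrder linked , eq

Bumps₀⇒LH : ∀ {n} α β → Bumps 0 n (0 ∷ parts α) (parts β) → α ⟶LH[ n ] β
Bumps₀⇒LH {n} α β b = go b refl
  where
  go : ∀ {bs} → Bumps 0 n (0 ∷ parts α) bs → bs ≡ parts β → α ⟶LH[ n ] β
  go done                        eq   = contradiction eq (0∷≢parts β)
  go (step {zero} _ here bs)     refl with Bumps⇒t* (1ᵖ ∷ α) β bs
  ... | is , linked , eq = 1 ∷ is , linked , eq
  go (step {zero} _ (there 0≢0 _) _) _ = contradiction refl 0≢0
  go (step {suc k} _ (there _ _) bs) refl with first-stays (s≤s z≤n) bs
  ... | _ , eq = contradiction eq (0∷≢parts β)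

-- The condition on the lengths a ≤ b of an upper row, and a′ ≤ b′ of a lower
-- row, before and after inserting the smallest entry.
Compatible : ℕ → ℕ → ℕ → ℕ → Set
Compatible a b a′ b′ = a′ ≡ b′ ⊎ b′ ≤ a ⊎ b < a′

-- A description of horizontal strips that mentions no order of adding boxes; it can therefore be
-- compared with the row-by-row conditions on tableaux.
data Interlaced : List ℕ → List ℕ → Set where
  []  : Interlaced [] []
  int : ∀ {a b as bs} → a ≤ b → Pointwise (Compatible a b) as bs → Interlaced as bs →
        Interlaced (a ∷ as) (b ∷ bs)

-- The trace that the bound i of `Bumps i` leaves on the initial and final lengths.
GrowsFrom : ℕ → List ℕ → List ℕ → Set
GrowsFrom i = Pointwise (λ a b → a < b → i ≤ a)

GrowsFrom-weaken : ∀ {i j as bs} → i ≤ j → GrowsFrom j as bs → GrowsFrom i as bs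
GrowsFrom-weaken i≤j = Pointwise.map λ g a<b → ℕ.≤-trans i≤j (g a<b)

Interlaced-refl : ∀ as → Interlaced as as
Interlaced-refl []       = []
Interlaced-refl (a ∷ as) = int ℕ.≤-refl (Pointwise.refl (inj₁ refl)) (Interlaced-refl as)

GrowsFrom-refl : ∀ {i} as → GrowsFrom i as as
GrowsFrom-refl as = Pointwise.refl λ {a} a<a → contradiction a<a (ℕ.<-irrefl refl)

Bump-sum : ∀ {k as bs} → Bump k as bs → sum bs ≡ suc (sum as)
Bump-sum here                       = refl
Bump-sum (there {a = a} {as} _ b)   = ≡.trans (≡.cong (a +_) (Bump-sum b)) (ℕ.+-suc a (sum as))

-- The leftmost choice gives a ≢ k. If a < k, the upper row can no longer grow, so b = a < k. If k <
-- a, the added box lies within the upper row, so a lower row ending at k + 1 still ends within it.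
Compatible-unbump : ∀ {k a b as as′ bs} → Bump k as as′ → a ≢ k → a ≤ b → (a < b → suc k ≤ a) →
                    Pointwise (Compatible a b) as′ bs → Pointwise (Compatible a b) as bs
Compatible-unbump {k} {a} {b} here a≢k a≤b g (c ∷ cs) = go c ∷ cs
  where
  go : ∀ {b′} → Compatible a b (suc k) b′ → Compatible a b k b′
  go c with ℕ.<-cmp a k
  ... | tri≈ _ a≡k _ = contradiction a≡k a≢k
  ... | tri< a<k _ _ with ℕ.m≤n⇒m<n∨m≡n a≤b
  ...   | inj₁ a<b = contradiction (g a<b) (ℕ.<⇒≱ (ℕ.m<n⇒m<1+n a<k))
  ...   | inj₂ refl = inj₂ (inj₂ a<k)
  go (inj₁ refl)        | tri> _ _ k<a = inj₂ (inj₁ k<a)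
  go (inj₂ (inj₁ b′≤a)) | tri> _ _ k<a = inj₂ (inj₁ b′≤a)
  go (inj₂ (inj₂ b≤k))  | tri> _ _ k<a = contradiction (ℕ.≤-trans k<a a≤b) (ℕ.<⇒≱ b≤k)
Compatible-unbump (there _ bump) a≢k a≤b g (c ∷ cs) = c ∷ Compatible-unbump bump a≢k a≤b g cs

-- When the top row is unbumped, the critical alternative for a lower row is b′ ≤ k + 1: a row that
-- still grows starts at k + 1 or more, so it cannot end there. Such a row therefore stays
-- unchanged.
Interlaced-unbump : ∀ {k as as′ bs} → Bump k as as′ → Interlaced as′ bs → GrowsFrom (suc k) as′ bs →
                    Interlaced as bs × GrowsFrom k as bs
Interlaced-unbump {k} here (int {b = b} k<b cs il) (_ ∷ gs) =
  int (ℕ.<⇒≤ k<b) (go cs il gs) il , (λ _ → ℕ.≤-refl) ∷ GrowsFrom-weaken (ℕ.n≤1+n k) gs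
  where
  go : ∀ {as bs} → Pointwise (Compatible (suc k) b) as bs → Interlaced as bs →
       GrowsFrom (suc k) as bs → Pointwise (Compatible k b) as bs
  go []       _               _        = []
  go (c ∷ cs) (int a≤b _ il) (g ∷ gs) = one c (ℕ.m≤n⇒m<n∨m≡n a≤b) g ∷ go cs il gs
    where
    one : ∀ {a′ b′} → Compatible (suc k) b a′ b′ → a′ < b′ ⊎ a′ ≡ b′ → (a′ < b′ → suc k ≤ a′) →
          Compatible k b a′ b′
    one c                    (inj₂ eq)  g = inj₁ eq
    one (inj₁ eq)            (inj₁ _)   g = inj₁ eq
    one (inj₂ (inj₂ b<a))    (inj₁ _)   g = inj₂ (inj₂ b<a)
    one (inj₂ (inj₁ b′≤1+k)) (inj₁ a<b) g = contradiction a<b (ℕ.≤⇒≯ (ℕ.≤-trans b′≤1+k (g a<b)))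
Interlaced-unbump {k} (there a≢k bump) (int a≤b cs il) (g ∷ gs)
  with Interlaced-unbump bump il gs
... | il′ , gs′ = int a≤b (Compatible-unbump bump a≢k a≤b g cs) il′ ,
                  (λ a<b → ℕ.≤-trans (ℕ.n≤1+n k) (g a<b)) ∷ gs′

Bumps⇒Interlaced : ∀ {i n as bs} → Bumps i n as bs → Interlaced as bs × GrowsFrom i as bs
Bumps⇒Interlaced {as = as} done = Interlaced-refl as , GrowsFrom-refl as
Bumps⇒Interlaced (step i≤k bump bs) with Bumps⇒Interlaced bs
... | il , gs with Interlaced-unbump bump il gs
...   | il′ , gs′ = il′ , GrowsFrom-weaken i≤k gs′

Pointwise-bump : ∀ {k as as′ bs} {P : ℕ → ℕ → Set} → Bump k as as′ → Pointwise _≤_ as′ bs →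
  (∀ {b} → k < b → P k b → P (suc k) b) → Pointwise P as bs → Pointwise P as′ bs
Pointwise-bump here           (k<b ∷ _)  f (p ∷ ps) = f k<b p ∷ ps
Pointwise-bump (there _ bump) (_ ∷ ≤s)   f (p ∷ ps) = p ∷ Pointwise-bump bump ≤s f ps

bumped : ∀ {k as as′ bs} {P : ℕ → ℕ → Set} → Bump k as as′ → Pointwise _≤_ as′ bs →
  Pointwise P as bs → ∃[ b ] k < b × P k b
bumped here           (k<b ∷ _) (p ∷ _)  = _ , k<b , p
bumped (there _ bump) (_ ∷ ≤s)  (_ ∷ ps) = bumped bump ≤s ps

Interlaced⇒≤ : ∀ {as bs} → Interlaced as bs → Pointwise _≤_ as bs
Interlaced⇒≤ []             = []
Interlaced⇒≤ (int a≤b _ il) = a≤b ∷ Interlaced⇒≤ il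

Compatible-suc : ∀ {a b k b′} → Compatible a b k b′ → k < b′ → Compatible a b (suc k) b′
Compatible-suc (inj₁ refl)        k<b′ = contradiction k<b′ (ℕ.<-irrefl refl)
Compatible-suc (inj₂ (inj₁ b′≤a)) k<b′ = inj₂ (inj₁ b′≤a)
Compatible-suc (inj₂ (inj₂ b<k))  k<b′ = inj₂ (inj₂ (ℕ.m<n⇒m<1+n b<k))

-- Makes the row to be bumped the leftmost of its length: each alternative of `Compatible` forbids a
-- lower row to grow from the initial length of an upper one.
Compatible-bump-≢ : ∀ {k a b as as′ bs} → a ≤ b → Pointwise (Compatible a b) as bs → Bump k as as′ →
                    Pointwise _≤_ as′ bs → a ≢ k
Compatible-bump-≢ a≤b cs bump ≤s refl with bumped bump ≤s cs
... | _ , k<k , inj₁ refl        = ℕ.<-irrefl refl k<k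
... | _ , k<b , inj₂ (inj₁ b≤k)  = ℕ.<⇒≱ k<b b≤k
... | _ , _   , inj₂ (inj₂ b<k)  = ℕ.<⇒≱ b<k a≤b

-- The row to bump is the shortest one that still has to grow; the induction compares the first row
-- with the choice made below it. All remaining growth then starts from lengths at least k + 1, as
-- increasing letters require.
Interlaced-first-bump : ∀ {as bs} → Interlaced as bs → as ≡ bs ⊎
  (∃[ k ] ∃[ as′ ] Bump k as as′ × Interlaced as′ bs × GrowsFrom (suc k) as′ bs × GrowsFrom k as bs)
Interlaced-first-bump [] = inj₁ refl
Interlaced-first-bump (int {a} {b} {as} {bs} a≤b cs il) with Interlaced-first-bump il | ℕ.m≤n⇒m<n∨m≡n a≤b
... | inj₁ refl | inj₂ refl = inj₁ refl
... | inj₁ refl | inj₁ a<b  = inj₂ (a , suc a ∷ as , here ,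
  int a<b (Pointwise.refl (inj₁ refl)) il ,
  (λ _ → ℕ.≤-refl) ∷ GrowsFrom-refl as , (λ _ → ℕ.≤-refl) ∷ GrowsFrom-refl as)
... | inj₂ (k , as′ , bump , il′ , gs′ , gs) | inj₂ refl = inj₂ (k , a ∷ as′ ,
  there (Compatible-bump-≢ a≤b cs bump (Interlaced⇒≤ il′)) bump ,
  int a≤b (Pointwise-bump bump (Interlaced⇒≤ il′) (λ k<b′ c → Compatible-suc c k<b′) cs) il′ ,
  (λ a<a → contradiction a<a (ℕ.<-irrefl refl)) ∷ gs′ ,
  (λ a<a → contradiction a<a (ℕ.<-irrefl refl)) ∷ gs)
... | inj₂ (k , as′ , bump , il′ , gs′ , gs) | inj₁ a<b with ℕ.<-cmp a k
...   | tri< a<k _ _ = inj₂ (a , suc a ∷ as , here ,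
  int a<b (Pointwise.map (λ { (inj₁ eq) → inj₁ eq ; (inj₂ (inj₁ b′≤a)) → inj₂ (inj₁ (ℕ.m≤n⇒m≤1+n b′≤a))
                            ; (inj₂ (inj₂ b<a′)) → inj₂ (inj₂ b<a′) }) cs) il ,
  (λ _ → ℕ.≤-refl) ∷ GrowsFrom-weaken a<k gs , (λ _ → ℕ.≤-refl) ∷ GrowsFrom-weaken (ℕ.<⇒≤ a<k) gs)
...   | tri≈ _ a≡k _ = contradiction a≡k (Compatible-bump-≢ a≤b cs bump (Interlaced⇒≤ il′))
...   | tri> _ a≢k k<a = inj₂ (k , a ∷ as′ , there a≢k bump ,
  int a≤b (Pointwise-bump bump (Interlaced⇒≤ il′) (λ k<b′ c → Compatible-suc c k<b′) cs) il′ ,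
  (λ _ → k<a) ∷ gs′ , (λ _ → ℕ.<⇒≤ k<a) ∷ gs)

Interlaced⇒Bumps : ∀ {i} n {as bs} → Interlaced as bs → GrowsFrom i as bs → sum bs ≡ sum as + n →
                   Bumps i n as bs
Interlaced⇒Bumps n {as} il gs eq with Interlaced-first-bump il
Interlaced⇒Bumps zero         il gs eq | inj₁ refl = done
Interlaced⇒Bumps (suc n) {as} il gs eq | inj₁ refl =
  contradiction eq (ℕ.<⇒≢ (ℕ.m<m+n (sum as) (s≤s z≤n)))
Interlaced⇒Bumps zero {as} {bs} il gs eq | inj₂ (k , as′ , bump , il′ , _) = contradiction
  (≡.subst (sum as′ ≤_) (≡.trans eq (ℕ.+-identityʳ _)) (Pointwise-sum (Interlaced⇒≤ il′)))
  (ℕ.<⇒≱ (ℕ.≤-reflexive (≡.sym (Bump-sum bump))))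
  where
  Pointwise-sum : ∀ {as bs} → Pointwise _≤_ as bs → sum as ≤ sum bs
  Pointwise-sum []         = z≤n
  Pointwise-sum (a≤b ∷ ps) = ℕ.+-mono-≤ a≤b (Pointwise-sum ps)
Interlaced⇒Bumps (suc n) {as} {bs} il gs eq | inj₂ (k , as′ , bump , il′ , gs′ , gs″)
  with bumped bump (Interlaced⇒≤ il′) gs
... | _ , k<b , i≤k = step (i≤k k<b) bump (Interlaced⇒Bumps n il′ gs′
  (≡.trans eq (≡.trans (ℕ.+-suc (sum as) n) (≡.cong (_+ n) (≡.sym (Bump-sum bump))))))

Bumps-sum : ∀ {i n as bs} → Bumps i n as bs → sum bs ≡ sum as + n
Bumps-sum done = ≡.sym (ℕ.+-identityʳ _)
Bumps-sum (step {n = n} {as} _ bump bs) = ≡.trans (Bumps-sum bs)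
  (≡.trans (≡.cong (_+ n) (Bump-sum bump)) (≡.sym (ℕ.+-suc (sum as) n)))

LH⇒Interlaced : ∀ {n α β} → α ⟶LH[ n ] β →
  (Interlaced (parts α) (parts β) ⊎ Interlaced (0 ∷ parts α) (parts β)) × size β ≡ size α + n
LH⇒Interlaced {n} {α} {β} s with LH⇒Bumps {n} {α} {β} s
... | inj₁ bs = inj₁ (proj₁ (Bumps⇒Interlaced bs)) , Bumps-sum bs
... | inj₂ bs = inj₂ (proj₁ (Bumps⇒Interlaced bs)) , Bumps-sum bs

Interlaced⇒LH : ∀ {n} α β → Interlaced (parts α) (parts β) ⊎ Interlaced (0 ∷ parts α) (parts β) →
  size β ≡ size α + n → α ⟶LH[ n ] β
Interlaced⇒LH {n} α β (inj₁ il) eq = Bumps₁⇒LH α β (Interlaced⇒Bumps n il (positive α il) eq)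
  where
  positive : ∀ α {bs} → Interlaced (parts α) bs → GrowsFrom 1 (parts α) bs
  positive []                 []           = []
  positive (part (suc _) ∷ α) (int _ _ il) = (λ _ → s≤s z≤n) ∷ positive α il
Interlaced⇒LH {n} α β (inj₂ il) eq = Bumps₀⇒LH α β (Interlaced⇒Bumps n il (anywhere il) eq)
  where
  anywhere : ∀ {as bs} → Interlaced as bs → GrowsFrom 0 as bs
  anywhere []           = []
  anywhere (int _ _ il) = (λ _ → z≤n) ∷ anywhere il

-- Removing the ones from a tableau

-- In a weakly decreasing positive row the ones form a tail, so cutting at the first one deletes
-- exactly them.
lower : List ℕ → List ℕ
lower []                = []
lower (zero ∷ r)        = []
lower (suc zero ∷ r)    = []
lower (suc (suc x) ∷ r) = suc x ∷ lower r

raise : ℕ → List ℕ → List ℕ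
raise zero    r       = []
raise (suc b) []      = 1 ∷ raise b []
raise (suc b) (x ∷ r) = suc x ∷ raise b r

Positive : List ℕ → Set
Positive = All (1 ≤_)

length-raise : ∀ b r → length (raise b r) ≡ b
length-raise zero    r       = refl
length-raise (suc b) []      = ≡.cong suc (length-raise b [])
length-raise (suc b) (x ∷ r) = ≡.cong suc (length-raise b r)

length-lower : ∀ r → length (lower r) ≤ length r
length-lower []                = z≤n
length-lower (zero ∷ r)        = z≤n
length-lower (suc zero ∷ r)    = z≤n
length-lower (suc (suc x) ∷ r) = s≤s (length-lower r)

raise-lower : ∀ {r} → Positive r → Linked _≥_ r → raise (length r) (lower r) ≡ r
raise-lower {[]}              _       _ = refl
raise-lower {suc zero ∷ r}    (_ ∷ ps) l = ≡.cong (1 ∷_) (ones ps l)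
  where
  ones : ∀ {r} → Positive r → Linked _≥_ (1 ∷ r) → raise (length r) [] ≡ r
  ones []              _              = refl
  ones (s≤s z≤n ∷ ps) (s≤s z≤n ∷ l) = ≡.cong (1 ∷_) (ones ps l)
raise-lower {suc (suc x) ∷ r} (_ ∷ ps) l = ≡.cong (suc (suc x) ∷_) (raise-lower ps (tail l))
  where
  tail : ∀ {x r} → Linked _≥_ (x ∷ r) → Linked _≥_ r
  tail [-]     = []
  tail (_ ∷ l) = l

lower-raise : ∀ {b r} → Positive r → length r ≤ b → lower (raise b r) ≡ r
lower-raise {zero}  []               _        = refl
lower-raise {suc b} []               _        = refl
lower-raise {suc b} (s≤s z≤n ∷ ps)  (s≤s le) = ≡.cong (_ ∷_) (lower-raise ps le)

lower-positive : ∀ r → Positive (lower r)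
lower-positive []                = []
lower-positive (zero ∷ r)        = []
lower-positive (suc zero ∷ r)    = []
lower-positive (suc (suc x) ∷ r) = s≤s z≤n ∷ lower-positive r

lower-bounded : ∀ {k r} → All (_≤ suc k) r → All (_≤ k) (lower r)
lower-bounded []                              = []
lower-bounded {r = zero ∷ r}        (_ ∷ _)   = []
lower-bounded {r = suc zero ∷ r}    (_ ∷ _)   = []
lower-bounded {r = suc (suc x) ∷ r} (le ∷ ps) = s≤s⁻¹ le ∷ lower-bounded ps

raise-positive : ∀ b r → Positive (raise b r)
raise-positive zero    r       = []
raise-positive (suc b) []      = s≤s z≤n ∷ raise-positive b []
raise-positive (suc b) (x ∷ r) = s≤s z≤n ∷ raise-positive b r

raise-bounded : ∀ {k} b {r} → All (_≤ k) r → All (_≤ suc k) (raise b r)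
raise-bounded zero    _         = []
raise-bounded (suc b) []        = s≤s z≤n ∷ raise-bounded b []
raise-bounded (suc b) (le ∷ ps) = s≤s le ∷ raise-bounded b ps

entry-beyond : ∀ r {c} → length r ≤ c → entry r c ≡ 0
entry-beyond []      _        = refl
entry-beyond (x ∷ r) (s≤s le) = entry-beyond r le

entry-positive : ∀ {r c} → Positive r → c < length r → 1 ≤ entry r c
entry-positive {c = zero}  (p ∷ _)  _        = p
entry-positive {c = suc c} (_ ∷ ps) (s≤s lt) = entry-positive ps lt

entry-raise-< : ∀ {b} r {c} → c < b → entry (raise b r) c ≡ suc (entry r c)
entry-raise-< []      {zero}  (s≤s _)  = refl
entry-raise-< []      {suc c} (s≤s lt) = entry-raise-< [] lt
entry-raise-< (x ∷ r) {zero}  (s≤s _)  = refl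
entry-raise-< (x ∷ r) {suc c} (s≤s lt) = entry-raise-< r lt

entry-raise-≥ : ∀ {b} r {c} → b ≤ c → entry (raise b r) c ≡ 0
entry-raise-≥ {b} r b≤c = entry-beyond (raise b r) (≡.subst (_≤ _) (≡.sym (length-raise b r)) b≤c)

entry-raise-≤ : ∀ b r c → entry (raise b r) c ≤ suc (entry r c)
entry-raise-≤ b r c with c ℕ.<? b
... | yes c<b = ℕ.≤-reflexive (entry-raise-< r c<b)
... | no  c≮b rewrite entry-raise-≥ r (ℕ.≮⇒≥ c≮b) = z≤n

-- The tableau conditions under insertion of ones

Decreasing : List ℕ → Set
Decreasing r = ∀ c → entry r (suc c) ≤ entry r c

Linked⇒Decreasing : ∀ {r} → Linked _≥_ r → Decreasing r
Linked⇒Decreasing []      c       = z≤n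
Linked⇒Decreasing [-]     c       = z≤n
Linked⇒Decreasing (g ∷ l) zero    = g
Linked⇒Decreasing (g ∷ l) (suc c) = Linked⇒Decreasing l c

Decreasing⇒Linked : ∀ {r} → Decreasing r → Linked _≥_ r
Decreasing⇒Linked {[]}        d = []
Decreasing⇒Linked {x ∷ []}    d = [-]
Decreasing⇒Linked {x ∷ y ∷ r} d = d 0 ∷ Decreasing⇒Linked (d ∘ suc)

-- `Triple` with arbitrary column numbers, so that columns at and beyond the ends of rows can be
-- inspected; there the zero extension makes the condition vacuous.
Triple′ : Rel (List ℕ) 0ℓ
Triple′ u l = ∀ c → entry l (suc c) ≢ 0 → entry l (suc c) ≥ entry u (suc c) → entry l (suc c) > entry u c

Triple⇒Triple′ : ∀ u l → Triple u l → Triple′ u l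
Triple⇒Triple′ u l t c with c ℕ.<? length l
... | yes c<l = ≡.subst (λ c → entry l (suc c) ≢ 0 → entry l (suc c) ≥ entry u (suc c) → entry l (suc c) > entry u c)
                        (toℕ-fromℕ< c<l) (t (fromℕ< c<l))
... | no  c≮l = λ ≢0 → contradiction (entry-beyond l (ℕ.m≤n⇒m≤1+n (ℕ.≮⇒≥ c≮l))) ≢0

Triple′⇒Triple : ∀ u l → Triple′ u l → Triple u l
Triple′⇒Triple u l t c = t (toℕ c)

-- A row together with its length after insertion of ones.
Fits : List ℕ × ℕ → Set
Fits (r , b) = Positive r × length r ≤ b × 1 ≤ b

Compatible′ : Rel (List ℕ × ℕ) 0ℓ
Compatible′ (r , b) (r′ , b′) = Compatible (length r) b (length r′) b′

raise′ : List ℕ × ℕ → List ℕ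
raise′ (r , b) = raise b r

FirstColumn : Rel (List ℕ) 0ℓ
FirstColumn u l = entry u 0 < entry l 0

nonempty : ∀ r → 0 < entry r 0 → 1 ≤ length r
nonempty (x ∷ r) _ = s≤s z≤n

module _ {x y : List ℕ × ℕ} (fx : Fits x) (fy : Fits y) where

  private
    r r′ : List ℕ
    r  = proj₁ x
    r′ = proj₁ y
    b b′ a a′ : ℕ
    b  = proj₂ x
    b′ = proj₂ y
    a  = length r
    a′ = length r′
    a≤b : a ≤ b
    a≤b = proj₁ (proj₂ fx)
    a′≤b′ : a′ ≤ b′
    a′≤b′ = proj₁ (proj₂ fy)

  FirstColumn-raise⁻ : FirstColumn (raise′ x) (raise′ y) → FirstColumn r r′
  FirstColumn-raise⁻ lt = s≤s⁻¹ (≡.subst₂ _<_ (entry-raise-< r (proj₂ (proj₂ fx))) (entry-raise-< r′ (proj₂ (proj₂ fy))) lt)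

  FirstColumn-raise⁺ : FirstColumn r r′ → FirstColumn (raise′ x) (raise′ y)
  FirstColumn-raise⁺ lt = ≡.subst₂ _<_ (≡.sym (entry-raise-< r (proj₂ (proj₂ fx)))) (≡.sym (entry-raise-< r′ (proj₂ (proj₂ fy)))) (s≤s lt)

  Triple′-raise⁻ : Triple′ (raise′ x) (raise′ y) → Triple′ r r′
  Triple′-raise⁻ t c ≢0 ge with suc c ℕ.<? a′
  ... | no ≮   = contradiction (entry-beyond r′ (ℕ.≮⇒≥ ≮)) ≢0
  ... | yes <a′ with c ℕ.<? b
  ...   | no ≮b rewrite entry-beyond r (ℕ.≤-trans a≤b (ℕ.≮⇒≥ ≮b)) = entry-positive (proj₁ fy) <a′
  ...   | yes <b with t c
  ...     | t′ rewrite entry-raise-< r′ (ℕ.≤-trans <a′ a′≤b′) | entry-raise-< r <b =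
    s≤s⁻¹ (t′ (λ ()) (ℕ.≤-trans (entry-raise-≤ b r (suc c)) (s≤s ge)))

  -- In the added part of the lower row all entries are 1, and 1 exceeds
  -- exactly the zeros outside the upper row.
  Triple′⇒Compatible : 1 ≤ a′ → Triple′ (raise′ x) (raise′ y) → Compatible a b a′ b′
  Triple′⇒Compatible 1≤a′ t with ℕ.m≤n⇒m<n∨m≡n a′≤b′
  ... | inj₂ eq    = inj₁ eq
  ... | inj₁ a′<b′ with a ℕ.≤? a′
  -- The test column is a′ = d + 1, the first added one of the lower row. The upper entry there is
  -- at most 1, so the triple condition makes the upper row empty in column d, which says b < a′.
  ...   | yes a≤a′ = inj₂ (inj₂ (gap a′ refl 1≤a′))
    where
    gap : ∀ m → m ≡ a′ → 1 ≤ m → b < a′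
    gap (suc d) eq _ with d ℕ.<? b
    ... | no d≮b = ≡.subst (b <_) eq (s≤s (ℕ.≮⇒≥ d≮b))
    ... | yes d<b with t d
    ...   | t′ rewrite entry-raise-< r′ (≡.subst (_< b′) (≡.sym eq) a′<b′)
                     | entry-beyond r′ (ℕ.≤-reflexive (≡.sym eq))
                     | entry-raise-< r d<b
                     with t′ (λ ()) (≡.subst (λ z → entry (raise b r) (suc d) ≤ suc z)
                       (entry-beyond r (≡.subst (a ≤_) (≡.sym eq) a≤a′)) (entry-raise-≤ b r (suc d)))
    ...     | s≤s ()
  ...   | no a≰a′ with b′ ℕ.≤? a
  ...     | yes b′≤a = inj₂ (inj₁ b′≤a)
  -- The test column is a = c + 1, just past the original upper row. The lower entry there is an
  -- added one and the upper entry is at most 1, so the upper row would have to be empty in column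
  -- c, where it has an original entry.
  ...     | no b′≰a  = contradiction refl (gap a refl)
    where
    gap : ∀ m → m ≡ a → m ≢ a
    gap zero    eq _ = contradiction z≤n (≡.subst (λ m → ¬ m ≤ a′) (≡.sym eq) a≰a′)
    gap (suc c) eq _ with t c
    ... | t′ rewrite entry-raise-< r′ (≡.subst (_< b′) (≡.sym eq) (ℕ.≰⇒> b′≰a))
                   | entry-beyond r′ (≡.subst (a′ ≤_) (≡.sym eq) (ℕ.<⇒≤ (ℕ.≰⇒> a≰a′)))
                   | entry-raise-< r (≡.subst (_≤ b) (≡.sym eq) a≤b)
                   with t′ (λ ()) (≡.subst (λ z → entry (raise b r) (suc c) ≤ suc z)
                     (entry-beyond r (ℕ.≤-reflexive (≡.sym eq))) (entry-raise-≤ b r (suc c)))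
    ...   | s≤s ()

  Triple′-raise⁺ : Triple′ r r′ → Compatible a b a′ b′ → Triple′ (raise′ x) (raise′ y)
  Triple′-raise⁺ t comp c ≢0 ge with suc c ℕ.<? b′
  ... | no ≮b′  = contradiction (entry-raise-≥ r′ (ℕ.≮⇒≥ ≮b′)) ≢0
  ... | yes <b′ rewrite entry-raise-< r′ <b′ with c ℕ.<? b
  ...   | no ≮b rewrite entry-raise-≥ r (ℕ.≮⇒≥ ≮b) = s≤s z≤n
  ...   | yes <b rewrite entry-raise-< r <b with suc c ℕ.<? a′
  ...     | yes <a′ = s≤s (t c (λ eq → ℕ.<⇒≢ (entry-positive (proj₁ fy) <a′) (≡.sym eq)) ge′)
    where
    ge′ : entry r′ (suc c) ≥ entry r (suc c)
    ge′ with suc c ℕ.<? b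
    ... | yes <b′ rewrite entry-raise-< r <b′ = s≤s⁻¹ ge
    ... | no ≮b′ rewrite entry-beyond r (ℕ.≤-trans a≤b (ℕ.≮⇒≥ ≮b′)) = z≤n
  -- The lower entry is now an added one, and column c of the upper row is occupied. Under
  -- `Compatible` this happens only below an original upper entry, which has become at least 2 and
  -- so contradicts `ge`.
  ...     | no ≮a′ = contradiction comp incompatible
    where
    incompatible : ¬ Compatible a b a′ b′
    incompatible (inj₁ eq) = ≮a′ (≡.subst (suc c <_) (≡.sym eq) <b′)
    incompatible (inj₂ (inj₁ b′≤a)) = ℕ.<⇒≱ (s≤s (entry-positive (proj₁ fx) <a))
      (≡.subst₂ _≤_ (entry-raise-< r (ℕ.≤-trans <a a≤b)) (≡.cong suc (entry-beyond r′ (ℕ.≮⇒≥ ≮a′))) ge)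
      where
      <a : suc c < a
      <a = ℕ.≤-trans <b′ b′≤a
    incompatible (inj₂ (inj₂ b<a′)) = ℕ.<⇒≱ <b (s≤s⁻¹ (ℕ.≤-trans b<a′ (ℕ.≮⇒≥ ≮a′)))

Decreasing-raise⁻ : ∀ {x} → Fits x → Decreasing (raise′ x) → Decreasing (proj₁ x)
Decreasing-raise⁻ {r , b} (_ , a≤b , _) d c with suc c ℕ.<? b
... | no ≮b rewrite entry-beyond r (ℕ.≤-trans a≤b (ℕ.≮⇒≥ ≮b)) = z≤n
... | yes <b = s≤s⁻¹ (≡.subst₂ _≤_ (entry-raise-< r <b) (entry-raise-< r (ℕ.<⇒≤ <b)) (d c))

Decreasing-raise⁺ : ∀ x → Decreasing (proj₁ x) → Decreasing (raise′ x)
Decreasing-raise⁺ (r , b) d c with suc c ℕ.<? b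
... | no ≮b rewrite entry-raise-≥ r (ℕ.≮⇒≥ ≮b) = z≤n
... | yes <b = ≡.subst₂ _≤_ (≡.sym (entry-raise-< r <b)) (≡.sym (entry-raise-< r (ℕ.<⇒≤ <b))) (s≤s (d c))

AllPairs-map-All : ∀ {P : A → Set ℓb} {R S : Rel A ℓb} → (∀ {x y} → P x → P y → R x y → S x y) →
  ∀ {xs} → All P xs → AllPairs R xs → AllPairs S xs
AllPairs-map-All f []         []         = []
AllPairs-map-All f (px ∷ pxs) (rs ∷ rss) =
  All.zipWith (λ (py , r) → f px py r) (pxs , rs) ∷ AllPairs-map-All f pxs rss

module _ {X : List (List ℕ × ℕ)} (fits : All Fits X) where

  IsTableau-raise⁻ : IsTableau (map raise′ X) → IsTableau (map proj₁ X) × AllPairs Compatible′ X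
  IsTableau-raise⁻ (l , f , t) =
    ( All.map⁺ (All.zipWith (λ {x} (fx , lx) → Decreasing⇒Linked (Decreasing-raise⁻ {x} fx (Linked⇒Decreasing lx)))
                            (fits , All.map⁻ l))
    , AllPairs.map⁺ first
    , AllPairs.map⁺ (AllPairs-map-All (λ {x} {y} fx fy → Triple′⇒Triple (proj₁ x) (proj₁ y) ∘ Triple′-raise⁻ {x} {y} fx fy ∘ Triple⇒Triple′ (raise′ x) (raise′ y))
                       fits triples) ) ,
    -- By the strict first column, a row below another one keeps an entry after the ones are
    -- removed; this provides 1 ≤ a′.
    AllPairs-map-All (λ {x} {y} fx fy (fc , tr) →
        Triple′⇒Compatible {x} {y} fx fy (nonempty (proj₁ y) (ℕ.≤-trans (s≤s z≤n) fc)) (Triple⇒Triple′ (raise′ x) (raise′ y) tr))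
      fits (AllPairs.zip (first , triples))
    where
    first : AllPairs (λ x y → FirstColumn (proj₁ x) (proj₁ y)) X
    first = AllPairs-map-All (λ {x} {y} fx fy → FirstColumn-raise⁻ {x} {y} fx fy) fits (AllPairs.map⁻ f)
    triples : AllPairs (λ x y → Triple (raise′ x) (raise′ y)) X
    triples = AllPairs.map⁻ t

  IsTableau-raise⁺ : IsTableau (map proj₁ X) → AllPairs Compatible′ X → IsTableau (map raise′ X)
  IsTableau-raise⁺ (l , f , t) comp =
    All.map⁺ (All.map (λ {x} lx → Decreasing⇒Linked (Decreasing-raise⁺ x (Linked⇒Decreasing lx))) (All.map⁻ l)) ,
    AllPairs.map⁺ (AllPairs-map-All (λ {x} {y} fx fy → FirstColumn-raise⁺ {x} {y} fx fy) fits (AllPairs.map⁻ f)) ,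
    AllPairs.map⁺ (AllPairs-map-All (λ {x} {y} fx fy (tr , co) →
        Triple′⇒Triple (raise′ x) (raise′ y) (Triple′-raise⁺ {x} {y} fx fy (Triple⇒Triple′ (proj₁ x) (proj₁ y) tr) co))
      fits (AllPairs.zip (AllPairs.map⁻ t , comp)))

-- The injection is given as a relation, so that the graph of `removeOnes` and its converse serve
-- for the two inequalities of `tableaux-count`.
length-≤ : (R : REL A B ℓd) → ∀ {xs ys} → Unique xs →
  (∀ {x} → x ∈ xs → ∃[ y ] y ∈ ys × R x y) →
  (∀ {x x′ y} → x ∈ xs → x′ ∈ xs → R x y → R x′ y → x ≡ x′) → length xs ≤ length ys
length-≤ R {[]}     u        f inj = z≤n
length-≤ R {x ∷ xs} (x∉ ∷ u) f inj with f (here refl)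
... | y , y∈ , rxy with ∈-∃++ y∈
...   | ys₁ , ys₂ , refl = ≡.subst (suc (length xs) ≤_)
  (≡.sym (≡.trans (length-++ ys₁) (≡.trans (ℕ.+-suc _ _) (≡.cong suc (≡.sym (length-++ ys₁))))))
  (s≤s (length-≤ R u g λ x∈ x′∈ → inj (there x∈) (there x′∈)))
  where
  g : ∀ {x} → x ∈ xs → ∃[ y ] y ∈ ys₁ ++ ys₂ × R x y
  g x′∈ with f (there x′∈)
  ... | y′ , y′∈ , rx′y′ with ∈-++⁻ ys₁ y′∈
  ...   | inj₁ y′∈₁           = y′ , ∈-++⁺ˡ y′∈₁ , rx′y′
  ...   | inj₂ (here refl)    = contradiction (inj (here refl) (there x′∈) rxy rx′y′) (All.lookup x∉ x′∈)
  ...   | inj₂ (there y′∈₂)   = y′ , ∈-++⁺ʳ ys₁ y′∈₂ , rx′y′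

concatMap-unique : ∀ (f : A → List B) {xs} → Unique xs → (∀ x → Unique (f x)) →
  (∀ {x x′ y} → y ∈ f x → y ∈ f x′ → x ≡ x′) → Unique (concatMap f xs)
concatMap-unique f []       uf disj = []
concatMap-unique f (x∉ ∷ u) uf disj = Unique.++⁺ (uf _) (concatMap-unique f u uf disj) λ (y∈ , y∈′) →
  let (x′ , x′∈ , y∈″) = find (∈-concatMap⁻ f y∈′) in All.lookup x∉ x′∈ (disj y∈ y∈″)

multiplicity-∷ : ∀ i x xs → multiplicity i (x ∷ xs) ≡ δℕ i x + multiplicity i xs
multiplicity-∷ i x xs with i ℕ.≟ x
... | yes refl = ≡.trans (≡.cong length (filter-accept (i ℕ.≟_) {xs = xs} refl))
                         (≡.cong (_+ multiplicity i xs) (≡.sym (δℕ-refl i)))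
... | no i≢x   = ≡.trans (≡.cong length (filter-reject (i ℕ.≟_) {xs = xs} i≢x))
                         (≡.cong (_+ multiplicity i xs) (≡.sym (δℕ-≢ i≢x)))

multiplicity-++ : ∀ i xs ys → multiplicity i (xs ++ ys) ≡ multiplicity i xs + multiplicity i ys
multiplicity-++ i []       ys = refl
multiplicity-++ i (x ∷ xs) ys = ≡.trans (multiplicity-∷ i x (xs ++ ys)) (≡.trans
  (≡.cong (δℕ i x +_) (multiplicity-++ i xs ys))
  (≡.trans (≡.sym (ℕ.+-assoc (δℕ i x) _ _)) (≡.cong (_+ multiplicity i ys) (≡.sym (multiplicity-∷ i x xs)))))

multiplicity-raise : ∀ i b {r} → length r ≤ b →
  multiplicity (suc (suc i)) (raise b r) ≡ multiplicity (suc i) r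
multiplicity-raise i zero    {[]}    _        = refl
multiplicity-raise i (suc b) {[]}    _        =
  ≡.trans (multiplicity-∷ (suc (suc i)) 1 (raise b [])) (multiplicity-raise i b {[]} z≤n)
multiplicity-raise i (suc b) {x ∷ r} (s≤s le) = ≡.trans (multiplicity-∷ (suc (suc i)) (suc x) (raise b r))
  (≡.trans (≡.cong (δℕ (suc i) x +_) (multiplicity-raise i b le)) (≡.sym (multiplicity-∷ (suc i) x r)))

ones-raise : ∀ b {r} → Positive r → length r ≤ b → length r + multiplicity 1 (raise b r) ≡ b
ones-raise zero    []                       _        = refl
ones-raise (suc b) []                       _        =
  ≡.trans (multiplicity-∷ 1 1 (raise b [])) (≡.cong suc (ones-raise b [] z≤n))
ones-raise (suc b) {suc x ∷ r} (_ ∷ ps) (s≤s le) = ≡.cong suc (≡.trans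
  (≡.cong (length r +_) (multiplicity-∷ 1 (suc (suc x)) (raise b r))) (ones-raise b ps le))

multiplicity-raise-concat : ∀ i {X} → All Fits X →
  multiplicity (suc (suc i)) (concat (map raise′ X)) ≡ multiplicity (suc i) (concat (map proj₁ X))
multiplicity-raise-concat i []                                        = refl
multiplicity-raise-concat i {(r , b) ∷ X} ((ps , le , _) ∷ fits) =
  ≡.trans (multiplicity-++ (suc (suc i)) (raise b r) _) (≡.trans
    (≡.cong₂ _+_ (multiplicity-raise i b le) (multiplicity-raise-concat i fits))
    (≡.sym (multiplicity-++ (suc i) r _)))

ones-raise-concat : ∀ {X} → All Fits X →
  sum (map length (map proj₁ X)) + multiplicity 1 (concat (map raise′ X)) ≡ sum (map proj₂ X)
ones-raise-concat []                                    = refl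
ones-raise-concat {(r , b) ∷ X} ((ps , le , _) ∷ fits) = ≡.trans
  (≡.cong (length r + sum (map length (map proj₁ X)) +_) (multiplicity-++ 1 (raise b r) _))
  (≡.trans (+-interchange (length r) _ _ _) (≡.cong₂ _+_ (ones-raise b ps le) (ones-raise-concat fits)))

applyUpTo-cong : ∀ {f g : ℕ → A} n → (∀ i → f i ≡ g i) → applyUpTo f n ≡ applyUpTo g n
applyUpTo-cong zero    eq = refl
applyUpTo-cong (suc n) eq = ≡.cong₂ _∷_ (eq 0) (applyUpTo-cong n (eq ∘ suc))

content-raise : ∀ k {X} → All Fits X →
  content (suc k) (map raise′ X) ≡ multiplicity 1 (concat (map raise′ X)) ∷ content k (map proj₁ X)
content-raise k fits = ≡.cong (_ ∷_) (applyUpTo-cong k λ i → multiplicity-raise-concat i fits)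

-- Tableaux of given shape and content, and the bijection that removes their ones

tableaux : ℕ → Exponents → Composition → List Filling
tableaux k e α = filter (λ T → isTableau? T ×-dec (content k T ≟ᵉ e)) (fillings k α)

record IsTableauOf (k : ℕ) (e : Exponents) (α : Composition) (T : Filling) : Set where
  constructor isTableauOf
  field
    shape    : map length T ≡ parts α
    positive : All Positive T
    bounded  : All (All (_≤ k)) T
    tableau  : IsTableau T
    weight   : content k T ≡ e

∈-rows⁺ : ∀ {k r} → Positive r → All (_≤ k) r → r ∈ rows k (length r)
∈-rows⁺ []             []       = here refl
∈-rows⁺ (s≤s z≤n ∷ ps) (b ∷ bs) = ∈-cartesianProductWith⁺ _∷_ (∈-applyUpTo⁺ suc b) (∈-rows⁺ ps bs)

∈-rows⁻ : ∀ {k} n {r} → r ∈ rows k n → length r ≡ n × Positive r × All (_≤ k) r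
∈-rows⁻         zero    (here refl) = refl , [] , []
∈-rows⁻ {k} (suc n) r∈ with ∈-cartesianProductWith⁻ _∷_ (applyUpTo suc k) (rows k n) r∈
... | x , r , x∈ , r∈′ , refl with ∈-applyUpTo⁻ suc x∈ | ∈-rows⁻ n r∈′
...   | _ , i<k , refl | eq , ps , bs = ≡.cong suc eq , s≤s z≤n ∷ ps , i<k ∷ bs

∈-fillings⁺ : ∀ {k T} α → map length T ≡ parts α → All Positive T → All (All (_≤ k)) T → T ∈ fillings k α
∈-fillings⁺ {T = []}    []      eq ps bs = here refl
∈-fillings⁺ {T = r ∷ T} (p ∷ α) eq (pr ∷ ps) (br ∷ bs) with ∷-injective eq
... | eq₁ , eq₂ = ∈-cartesianProductWith⁺ _∷_
  (≡.subst (λ n → r ∈ rows _ n) eq₁ (∈-rows⁺ pr br)) (∈-fillings⁺ α eq₂ ps bs)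

∈-fillings⁻ : ∀ {k T} α → T ∈ fillings k α → map length T ≡ parts α × All Positive T × All (All (_≤ k)) T
∈-fillings⁻ []      (here refl) = refl , [] , []
∈-fillings⁻ {k} (p ∷ α) T∈ with ∈-cartesianProductWith⁻ _∷_ (rows k (value p)) (fillings k α) T∈
... | r , T , r∈ , T∈′ , refl with ∈-rows⁻ (value p) r∈ | ∈-fillings⁻ α T∈′
...   | eq₁ , pr , br | eq₂ , ps , bs = ≡.cong₂ _∷_ eq₁ eq₂ , pr ∷ ps , br ∷ bs

∈-tableaux⁺ : ∀ {k e} α {T} → IsTableauOf k e α T → T ∈ tableaux k e α
∈-tableaux⁺ α (isTableauOf sh ps bs tab w) = ∈-filter⁺ _ (∈-fillings⁺ α sh ps bs) (tab , w)

∈-tableaux⁻ : ∀ k e α {T} → T ∈ tableaux k e α → IsTableauOf k e α T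
∈-tableaux⁻ k e α T∈ with ∈-filter⁻ (λ T → isTableau? T ×-dec (content k T ≟ᵉ e)) {xs = fillings k α} T∈
... | T∈′ , tab , w with ∈-fillings⁻ α T∈′
...   | sh , ps , bs = isTableauOf sh ps bs tab w

rows-unique : ∀ k n → Unique (rows k n)
rows-unique k zero    = [] ∷ []
rows-unique k (suc n) = Unique.cartesianProductWith⁺ _∷_ ∷-injective
  (Unique.applyUpTo⁺₁ suc k λ i<j _ → ℕ.<⇒≢ (s≤s i<j)) (rows-unique k n)

fillings-unique : ∀ k α → Unique (fillings k α)
fillings-unique k []      = [] ∷ []
fillings-unique k (p ∷ α) = Unique.cartesianProductWith⁺ _∷_ ∷-injective
  (rows-unique k (value p)) (fillings-unique k α)

tableaux-unique : ∀ k e α → Unique (tableaux k e α)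
tableaux-unique k e α = Unique.filter⁺ (λ T → isTableau? T ×-dec (content k T ≟ᵉ e)) (fillings-unique k α)

-- Only the top row can vanish, since the first column increases strictly. This is the case in which
-- the word of the strip starts with the letter 1.
dropEmpty : Filling → Filling
dropEmpty ([] ∷ T) = T
dropEmpty T        = T

removeOnes : Filling → Filling
removeOnes T = dropEmpty (map lower T)

loweredRows : Filling → List (List ℕ × ℕ)
loweredRows = map λ r → lower r , length r

loweredRows-lower : ∀ T → map proj₁ (loweredRows T) ≡ map lower T
loweredRows-lower T = ≡.sym (map-∘ T)

loweredRows-length : ∀ T → map proj₂ (loweredRows T) ≡ map length T
loweredRows-length T = ≡.sym (map-∘ T)

loweredRows-raise : ∀ {T} → All Positive T → All (Linked _≥_) T → map raise′ (loweredRows T) ≡ T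
loweredRows-raise []       []       = refl
loweredRows-raise (p ∷ ps) (l ∷ ls) = ≡.cong₂ _∷_ (raise-lower p l) (loweredRows-raise ps ls)

parts-positive : ∀ α → Positive (parts α)
parts-positive []                 = []
parts-positive (part (suc k) ∷ α) = s≤s z≤n ∷ parts-positive α

loweredRows-fits : ∀ {T} → Positive (map length T) → All Fits (loweredRows T)
loweredRows-fits {[]}    []       = []
loweredRows-fits {r ∷ T} (p ∷ ps) = (lower-positive r , length-lower r , p) ∷ loweredRows-fits ps

composition : (T : Filling) → Positive (map length T) → ∃[ α ] map length T ≡ parts α
composition []            []       = [] , refl
composition ((x ∷ r) ∷ T) (_ ∷ ps) with composition T ps
... | α , eq = part (suc (length r)) ∷ α , ≡.cong (_ ∷_) eq

interlaced⁺ : ∀ {X} → All Fits X → AllPairs Compatible′ X →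
  Interlaced (map length (map proj₁ X)) (map proj₂ X)
interlaced⁺ []                      []         = []
interlaced⁺ {(r , b) ∷ X} ((_ , le , _) ∷ fits) (c ∷ cs) = int le (pointwise (r , b) X c) (interlaced⁺ fits cs)
  where
  pointwise : ∀ x X → All (Compatible′ x) X →
    Pointwise (Compatible (length (proj₁ x)) (proj₂ x)) (map length (map proj₁ X)) (map proj₂ X)
  pointwise x []      []       = []
  pointwise x (_ ∷ X) (c ∷ cs) = c ∷ pointwise x X cs

interlaced⁻ : ∀ {T bs} → Interlaced (map length T) bs → All Positive T → Positive bs →
  ∃[ X ] map proj₁ X ≡ T × map proj₂ X ≡ bs × All Fits X × AllPairs Compatible′ X
interlaced⁻ {[]}    []              _        _        = [] , refl , refl , [] , []
interlaced⁻ {r ∷ T} (int {b = b} le cs il) (p ∷ ps) (q ∷ qs) with interlaced⁻ il ps qs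
... | X , refl , refl , fits , comp = (r , b) ∷ X , refl , refl , (p , le , q) ∷ fits , pairs X cs ∷ comp
  where
  pairs : ∀ X → Pointwise (Compatible (length r) b) (map length (map proj₁ X)) (map proj₂ X) →
          All (Compatible′ (r , b)) X
  pairs []      []       = []
  pairs (x ∷ X) (c ∷ cs) = c ∷ pairs X cs

first-column-lengths : ∀ r {T} → All (FirstColumn r) T → Positive (map length T)
first-column-lengths r []                      = []
first-column-lengths r {r′ ∷ T} (lt ∷ lts) =
  nonempty r′ (ℕ.≤-trans (s≤s z≤n) lt) ∷ first-column-lengths r lts

module _ {n k : ℕ} {γ : Exponents} where

  removeOnes-tableau : ∀ {β T} → T ∈ tableaux (suc k) (n ∷ γ) β →
    ∃[ α ] α ⟶LH[ n ] β × removeOnes T ∈ tableaux k γ α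
  removeOnes-tableau {β} {T} T∈ =
    cases (map lower T) interlaced sizes lowPositive lowBounded lowTableau (proj₂ weights)
    where
    open IsTableauOf (∈-tableaux⁻ (suc k) (n ∷ γ) β T∈)
    X : List (List ℕ × ℕ)
    X = loweredRows T
    fits : All Fits X
    fits = loweredRows-fits (≡.subst Positive (≡.sym shape) (parts-positive β))
    raised : map raise′ X ≡ T
    raised = loweredRows-raise positive (proj₁ tableau)
    both : IsTableau (map proj₁ X) × AllPairs Compatible′ X
    both = IsTableau-raise⁻ fits (≡.subst IsTableau (≡.sym raised) tableau)
    lowTableau : IsTableau (map lower T)
    lowTableau = ≡.subst IsTableau (loweredRows-lower T) (proj₁ both)
    columns : map proj₂ X ≡ parts β
    columns = ≡.trans (loweredRows-length T) shape
    interlaced : Interlaced (map length (map lower T)) (parts β)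
    interlaced = ≡.subst₂ (λ T bs → Interlaced (map length T) bs) (loweredRows-lower T) columns
      (interlaced⁺ fits (proj₂ both))
    weights : multiplicity 1 (concat (map raise′ X)) ≡ n × content k (map lower T) ≡ γ
    weights with ∷-injective (≡.trans (≡.sym (content-raise k fits)) (≡.trans (≡.cong (content (suc k)) raised) weight))
    ... | eq₁ , eq₂ = eq₁ , ≡.trans (≡.cong (content k) (≡.sym (loweredRows-lower T))) eq₂
    sizes : size β ≡ sum (map length (map lower T)) + n
    sizes = ≡.trans (≡.cong sum (≡.sym columns)) (≡.trans (≡.sym (ones-raise-concat fits))
      (≡.cong₂ _+_ (≡.cong (sum ∘ map length) (loweredRows-lower T)) (proj₁ weights)))
    lowPositive : All Positive (map lower T)
    lowPositive = All.map⁺ (All.universal lower-positive T)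
    lowBounded : All (All (_≤ k)) (map lower T)
    lowBounded = All.map⁺ (All.map lower-bounded bounded)

    cases : ∀ U → Interlaced (map length U) (parts β) → size β ≡ sum (map length U) + n →
      All Positive U → All (All (_≤ k)) U → IsTableau U → content k U ≡ γ →
      ∃[ α ] α ⟶LH[ n ] β × dropEmpty U ∈ tableaux k γ α
    cases [] il sz ps bs tab w = [] , Interlaced⇒LH [] β (inj₁ il) sz ,
      ∈-tableaux⁺ [] (isTableauOf refl [] [] tab w)
    cases ([] ∷ U) il sz (_ ∷ ps) (_ ∷ bs) (_ ∷ ls , fc ∷ fcs , _ ∷ ts) w
      = let (α , eq) = composition U (first-column-lengths [] fc) in α ,
      Interlaced⇒LH α β (inj₂ (≡.subst (λ as → Interlaced (0 ∷ as) (parts β)) eq il))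
        (≡.trans sz (≡.cong (λ as → sum as + n) eq)) ,
      ∈-tableaux⁺ α (isTableauOf eq ps bs (ls , fcs , ts) w)
    cases U@((x ∷ r) ∷ U′) il sz ps bs tab@(_ , fc ∷ _ , _) w
      = let (α , eq) = composition U (s≤s z≤n ∷ first-column-lengths (x ∷ r) fc) in α ,
      Interlaced⇒LH α β (inj₁ (≡.subst (λ as → Interlaced as (parts β)) eq il))
        (≡.trans sz (≡.cong (λ as → sum as + n) eq)) ,
      ∈-tableaux⁺ α (isTableauOf eq ps bs tab w)

  -- The shape β supplies what `removeOnes` forgets: its number of parts tells whether an empty row
  -- was dropped, and its parts tell how many ones to restore in each row.
  removeOnes-injective : ∀ {β T U} → T ∈ tableaux (suc k) (n ∷ γ) β → U ∈ tableaux (suc k) (n ∷ γ) β →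
    removeOnes T ≡ removeOnes U → T ≡ U
  removeOnes-injective {β} {T} {U} T∈ U∈ eq =
    ≡.trans (recover T∈) (≡.trans (≡.cong (zipWith raise (parts β)) lowered) (≡.sym (recover U∈)))
    where
    recover : ∀ {T} → T ∈ tableaux (suc k) (n ∷ γ) β → T ≡ zipWith raise (parts β) (map lower T)
    recover {T} T∈ = ≡.trans (go positive (proj₁ tableau)) (≡.cong (λ bs → zipWith raise bs (map lower T)) shape)
      where
      open IsTableauOf (∈-tableaux⁻ (suc k) (n ∷ γ) β T∈)
      go : ∀ {T} → All Positive T → All (Linked _≥_) T → T ≡ zipWith raise (map length T) (map lower T)
      go []       []       = refl
      go (p ∷ ps) (l ∷ ls) = ≡.cong₂ _∷_ (≡.sym (raise-lower p l)) (go ps ls)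

    lengths : ∀ {T} → T ∈ tableaux (suc k) (n ∷ γ) β → length (map lower T) ≡ length (parts β)
    lengths {T} T∈ = ≡.trans (length-map lower T) (≡.trans (≡.sym (length-map length T))
      (≡.cong length (IsTableauOf.shape (∈-tableaux⁻ (suc k) (n ∷ γ) β T∈))))

    dropEmpty-injective : ∀ T U → length T ≡ length U → dropEmpty T ≡ dropEmpty U → T ≡ U
    dropEmpty-injective []            []            _   _    = refl
    dropEmpty-injective ([] ∷ T)      ([] ∷ U)      _   refl = refl
    dropEmpty-injective ((_ ∷ _) ∷ T) ((_ ∷ _) ∷ U) _   eq   = eq
    dropEmpty-injective ([] ∷ T)      ((_ ∷ _) ∷ U) len refl = contradiction len (ℕ.1+n≢n)
    dropEmpty-injective ((_ ∷ _) ∷ T) ([] ∷ U)      len refl = contradiction (≡.sym len) (ℕ.1+n≢n)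

    lowered : map lower T ≡ map lower U
    lowered = dropEmpty-injective (map lower T) (map lower U) (≡.trans (lengths T∈) (≡.sym (lengths U∈))) eq

  removeOnes-surjective : ∀ {α β U} → α ⟶LH[ n ] β → U ∈ tableaux k γ α →
    ∃[ T ] T ∈ tableaux (suc k) (n ∷ γ) β × removeOnes T ≡ U
  removeOnes-surjective {α} {β} {U} strip U∈ with LH⇒Interlaced {n} {α} {β} strip
  ... | il , sizes = cases il
    where
    open IsTableauOf (∈-tableaux⁻ k γ α U∈)

    -- V is U itself, or U below an empty row when the strip creates a new part.
    insert : ∀ V → Interlaced (map length V) (parts β) → sum (map length V) ≡ size α →
      All Positive V → All (All (_≤ k)) V → IsTableau V → content k V ≡ γ → dropEmpty V ≡ U →
      ∃[ T ] T ∈ tableaux (suc k) (n ∷ γ) β × removeOnes T ≡ U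
    insert V il sz ps bs tab w eq with interlaced⁻ il ps (parts-positive β)
    ... | X , refl , eqβ , fits , comp = map raise′ X ,
      ∈-tableaux⁺ β (isTableauOf
        (≡.trans (≡.sym (map-∘ X)) (≡.trans (map-cong (λ (r , b) → length-raise b r) X) eqβ))
        (All.map⁺ (All.universal (λ (r , b) → raise-positive b r) X))
        (All.map⁺ (All.map (λ {(r , b)} → raise-bounded b) (All.map⁻ bs)))
        (IsTableau-raise⁺ fits tab comp)
        (≡.trans (content-raise k fits) (≡.cong₂ _∷_ ones w))) ,
      ≡.trans (≡.cong dropEmpty (≡.trans (≡.sym (map-∘ X)) (map-cong-local (All.map (λ (p , le , _) → lower-raise p le) fits)))) eq
      where
      ones : multiplicity 1 (concat (map raise′ X)) ≡ n
      ones = ℕ.+-cancelˡ-≡ (size α) _ _ (≡.trans (≡.cong (_+ _) (≡.sym sz))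
        (≡.trans (ones-raise-concat fits) (≡.trans (≡.cong sum eqβ) sizes)))

    lengths : Positive (map length U)
    lengths = ≡.subst Positive (≡.sym shape) (parts-positive α)

    dropEmpty-id : ∀ {U} → Positive (map length U) → dropEmpty U ≡ U
    dropEmpty-id {[]}          _ = refl
    dropEmpty-id {[] ∷ U}      (() ∷ _)
    dropEmpty-id {(_ ∷ _) ∷ U} _ = refl

    first : ∀ {U} → Positive (map length U) → All Positive U → All (FirstColumn []) U
    first {[]}    _        _        = []
    first {r ∷ U} (l ∷ ls) (p ∷ ps) = entry-positive p l ∷ first ls ps

    cases : Interlaced (parts α) (parts β) ⊎ Interlaced (0 ∷ parts α) (parts β) →
      ∃[ T ] T ∈ tableaux (suc k) (n ∷ γ) β × removeOnes T ≡ U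
    cases (inj₁ il) = insert U (≡.subst (λ as → Interlaced as (parts β)) (≡.sym shape) il)
      (≡.cong sum shape) positive bounded tableau weight (dropEmpty-id lengths)
    cases (inj₂ il) = insert ([] ∷ U) (≡.subst (λ as → Interlaced (0 ∷ as) (parts β)) (≡.sym shape) il)
      (≡.cong sum shape) ([] ∷ positive) ([] ∷ bounded)
      ([] ∷ proj₁ tableau , first lengths positive ∷ proj₁ (proj₂ tableau) ,
       All.universal (λ r c ≢0 _ → ℕ.n≢0⇒n>0 ≢0) U ∷ proj₂ (proj₂ tableau))
      weight refl

  tableaux-count : ∀ β → length (tableaux (suc k) (n ∷ γ) β) ≡
                         length (concatMap (tableaux k γ) (LH-to n β))
  tableaux-count β = ℕ.≤-antisym
    (length-≤ (λ T U → removeOnes T ≡ U) (tableaux-unique (suc k) (n ∷ γ) β) forward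
      λ T∈ U∈ eq eq′ → removeOnes-injective {β} T∈ U∈ (≡.trans eq (≡.sym eq′)))
    (length-≤ (λ U T → removeOnes T ≡ U)
      -- The shape of a tableau recovers α, so the lists for different α are disjoint.
      (concatMap-unique (tableaux k γ) (stripsTo-unique ℕ._<?_ n β) (tableaux-unique k γ) λ T∈ T∈′ →
        parts-inj (≡.trans (≡.sym (IsTableauOf.shape (∈-tableaux⁻ k γ _ T∈))) (IsTableauOf.shape (∈-tableaux⁻ k γ _ T∈′))))
      backward λ _ _ eq eq′ → ≡.trans (≡.sym eq) eq′)
    where
    forward : ∀ {T} → T ∈ tableaux (suc k) (n ∷ γ) β →
      ∃[ U ] U ∈ concatMap (tableaux k γ) (LH-to n β) × removeOnes T ≡ U
    forward T∈ with removeOnes-tableau {β} T∈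
    ... | α , strip , U∈ = _ , ∈-concatMap⁺ (tableaux k γ) (lose (Strip⇒to strictOrder strip) U∈) , refl

    backward : ∀ {U} → U ∈ concatMap (tableaux k γ) (LH-to n β) →
      ∃[ T ] T ∈ tableaux (suc k) (n ∷ γ) β × removeOnes T ≡ U
    backward U∈ =
      let (α , α∈ , U∈′) = find (∈-concatMap⁻ (tableaux k γ) {xs = LH-to n β} U∈) in
      removeOnes-surjective (to⇒Strip strictOrder {n} {α} {β} α∈) U∈′

-- Functionals on NSym

-- The word of H n.
generator : ℕ → Composition
generator zero    = []
generator (suc n) = ⟨ suc n ⟩

LH-from-[] : ∀ {n β} → [] ⟶LH[ n ] β → β ≡ generator n
LH-from-[] {n} {β} s with LH⇒Interlaced {n} {[]} {β} s
LH-from-[] {zero}  {[]}             s | inj₁ [] , refl = refl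
LH-from-[] {zero}  {part (suc _) ∷ []} s | inj₂ (int _ [] []) , ()
LH-from-[] {suc n} {part m ∷ []}    s | inj₂ (int _ [] []) , eq with ≡.trans (≡.sym (ℕ.+-identityʳ m)) eq
... | refl = refl

[]⟶LH : ∀ n → [] ⟶LH[ n ] generator n
[]⟶LH zero    = Interlaced⇒LH [] [] (inj₁ []) refl
[]⟶LH (suc n) = Interlaced⇒LH [] ⟨ suc n ⟩ (inj₂ (int z≤n [] [])) (ℕ.+-identityʳ (suc n))

-- On the empty composition only `t 1` is defined, and a weakly decreasing word of positive letters
-- that starts with 1 is constant.
LV-from-[] : ∀ {n β} → [] ⟶LV[ n ] β → β ≡ ⟨1^ n ⟩
LV-from-[] {zero}  ([] , _ , refl) = refl
LV-from-[] {suc n} {β} (suc zero ∷ is , linked , eq) = ≡.trans (go 1 is linked eq) (≡.cong ⟨1^_⟩ (ℕ.+-comm n 1))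
  where
  go : ∀ {m} j (is : Vec ℕ m) → V.Linked _≥_ (1 ∷ is) → t* is ⟨1^ j ⟩ ≡ just β → β ≡ ⟨1^ m + j ⟩
  go j []                 _                        refl = refl
  go {suc m} j (suc zero ∷ is) (_ V.∷ linked)      eq   =
    ≡.trans (go (suc j) is linked eq) (≡.cong ⟨1^_⟩ (ℕ.+-suc m j))
  go j (suc (suc k) ∷ is) (s≤s () V.∷ _)           eq

[]⟶LV : ∀ n → [] ⟶LV[ n ] ⟨1^ n ⟩
[]⟶LV n = Vec.replicate n 1 , linked n , ≡.trans (ones n 0) (≡.cong (just ∘ ⟨1^_⟩) (ℕ.+-identityʳ n))
  where
  linked : ∀ n → V.Linked _≥_ (Vec.replicate n 1)
  linked zero          = V.[]
  linked (suc zero)    = V.[-]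
  linked (suc (suc n)) = s≤s z≤n V.∷ linked (suc n)
  ones : ∀ n j → t* (Vec.replicate n 1) ⟨1^ j ⟩ ≡ just ⟨1^ n + j ⟩
  ones zero    j = refl
  ones (suc n) j = ≡.trans (ones n (suc j)) (≡.cong (just ∘ ⟨1^_⟩) (ℕ.+-suc n j))

LH₀ : ∀ {α β} → α ⟶LH[ 0 ] β → α ≡ β
LH₀ ([] , _ , refl) = refl

module Proof {c ℓ₁ ℓ₂} (F : HeytingField c ℓ₁ ℓ₂) where

  open Over F
  open CommutativeRing ring
    using (setoid; semiring; +-cong; +-congˡ; +-congʳ; +-identityˡ; +-identityʳ; +-commutativeMonoid; +-group;
           *-cong; *-congˡ; *-congʳ; *-assoc; *-comm; *-identityˡ; *-identityʳ; *-commutativeMonoid; zeroˡ; zeroʳ)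
    renaming (refl to ≈-refl; sym to ≈-sym; trans to ≈-trans; reflexive to ≈-reflexive)
  open import Algebra.Properties.Group +-group using (∙-cancelʳ)
  open import Algebra.Properties.CommutativeSemigroup (CommutativeMonoid.commutativeSemigroup *-commutativeMonoid)
    using () renaming (x∙yz≈y∙xz to *-left-comm)
  open import Algebra.Properties.Monoid.Mult (CommutativeMonoid.monoid +-commutativeMonoid) using (×-homo-+)
  open Sums ring
  open StripSums ring using (δ₀)
  open StripInversion ring
  open import Relation.Binary.Reasoning.Setoid setoid

  ext : (A → Carrier) → Lin A → Carrier
  ext g v = ∑ᶠ v λ (k , x) → k *ᶠ g x

  ext-cong : ∀ {g h : A → Carrier} v → (∀ x → g x ≈ h x) → ext g v ≈ ext h v
  ext-cong v eq = ∑-cong v λ (k , x) → *-congˡ (eq x)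

  ext-basis : ∀ (g : A → Carrier) x → ext g (basis x) ≈ g x
  ext-basis g x = ≈-trans (+-identityʳ _) (*-identityˡ _)

  ext-*ˡ : ∀ k (g : A → Carrier) v → ext (λ x → k *ᶠ g x) v ≈ k *ᶠ ext g v
  ext-*ˡ k g v = ≈-trans (∑-cong v λ _ → *-left-comm _ _ _) (≈-sym (∑-*ˡ k v _))

  ext-*ʳ : ∀ k (g : A → Carrier) v → ext (λ x → g x *ᶠ k) v ≈ ext g v *ᶠ k
  ext-*ʳ k g v = ≈-trans (∑-cong v λ _ → ≈-sym (*-assoc _ _ _)) (≈-sym (∑-*ʳ k v _))

  ext-· : ∀ (g : A → Carrier) k v → ext g (k · v) ≈ k *ᶠ ext g v
  ext-· g k v = ≈-trans (∑-map _ v _) (≈-trans (∑-cong v λ _ → *-assoc _ _ _) (≈-sym (∑-*ˡ k v _)))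

  ext-∑ : ∀ (g : A → Carrier) (is : List B) f → ext g (∑ is f) ≈ ∑ᶠ is (λ i → ext g (f i))
  ext-∑ g is f = ∑-concatMap f is _

  ∑-ext : ∀ (is : List B) (g : B → A → Carrier) v →
    ext (λ x → ∑ᶠ is (λ i → g i x)) v ≈ ∑ᶠ is (λ i → ext (g i) v)
  ∑-ext is g v = ≈-trans (∑-cong v λ (k , x) → ∑-*ˡ k is _) (∑-swap v is _)

  ext-linear : ∀ (g : B → Carrier) (f : A → Lin B) v → ext g (linear f v) ≈ ext (λ x → ext g (f x)) v
  ext-linear g f v = ≈-trans (ext-∑ g v _) (∑-cong v λ (k , x) → ext-· g k (f x))

  ext-bilinear : ∀ (g : D → Carrier) (f : A → B → D) v w →
    ext g (bilinear f v w) ≈ ext (λ x → ext (λ y → g (f x y)) w) v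
  ext-bilinear g f v w = ≈-trans (∑-cartesianProductWith _ v w _)
    (∑-cong v λ _ → ≈-trans (∑-cong w λ _ → *-assoc _ _ _) (≈-sym (∑-*ˡ _ w _)))

  coefficient-ext : ∀ (_≟ᴬ_ : DecidableEquality A) v x → coefficient _≟ᴬ_ v x ≈ ext (λ y → 𝟙 (y ≟ᴬ x)) v
  coefficient-ext _≟ᴬ_ []            x = ≈-refl
  coefficient-ext _≟ᴬ_ ((k , y) ∷ v) x with y ≟ᴬ x
  ... | yes _ = +-cong (≈-sym (*-identityʳ k)) (coefficient-ext _≟ᴬ_ v x)
  ... | no _  = +-cong (≈-sym (zeroʳ k)) (coefficient-ext _≟ᴬ_ v x)

  ≈ᴺ-ext : ∀ {x y} → (∀ p → ext p x ≈ ext p y) → x ≈ᴺ y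
  ≈ᴺ-ext {x} {y} eq z = ≈-trans (coefficient-ext _≟_ x z) (≈-trans (eq _) (≈-sym (coefficient-ext _≟_ y z)))

  ext-coefficient : ∀ (_≟ᴬ_ : DecidableEquality A) g {v xs} → Unique xs →
    (∀ {y} → y ∈ map proj₂ v → y ∈ xs) → ext g v ≈ ∑ᶠ xs (λ x → coefficient _≟ᴬ_ v x *ᶠ g x)
  ext-coefficient _≟ᴬ_ g {v} {xs} u ∈xs = begin
    ext g v
      ≈⟨ ∑-cong∈ v (λ {(k , y)} y∈ → *-congˡ (≈-sym (∑-select _≟ᴬ_ g u (∈xs (∈-map⁺ proj₂ y∈))))) ⟩
    ext (λ y → ∑ᶠ xs (λ x → 𝟙 (x ≟ᴬ y) *ᶠ g x)) v
      ≈⟨ ∑-ext xs _ v ⟩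
    ∑ᶠ xs (λ x → ext (λ y → 𝟙 (x ≟ᴬ y) *ᶠ g x) v)
      ≈⟨ ∑-cong xs (λ x → ≈-trans (ext-cong v λ y → *-congʳ (𝟙-cong (x ≟ᴬ y) (y ≟ᴬ x) ≡.sym ≡.sym))
           (≈-trans (ext-*ʳ (g x) _ v) (*-congʳ (≈-sym (coefficient-ext _≟ᴬ_ v x))))) ⟩
    ∑ᶠ xs (λ x → coefficient _≟ᴬ_ v x *ᶠ g x) ∎

  -- Equal coefficients do not make the lists of terms comparable, so the terms of both are
  -- collected over the joint list of their basis elements.
  ext-resp : ∀ (_≟ᴬ_ : DecidableEquality A) g {v w} → v ≈[ _≟ᴬ_ ] w → ext g v ≈ ext g w
  ext-resp {A = A} _≟ᴬ_ g {v} {w} v≈w = begin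
    ext g v
      ≈⟨ ext-coefficient _≟ᴬ_ g {v} (deduplicate-! _≟ᴬ_ keys) (λ y∈ → ∈-deduplicate⁺ _≟ᴬ_ (∈-++⁺ˡ y∈)) ⟩
    ∑ᶠ (deduplicate _≟ᴬ_ keys) (λ x → coefficient _≟ᴬ_ v x *ᶠ g x)
      ≈⟨ ∑-cong (deduplicate _≟ᴬ_ keys) (λ x → *-congʳ (v≈w x)) ⟩
    ∑ᶠ (deduplicate _≟ᴬ_ keys) (λ x → coefficient _≟ᴬ_ w x *ᶠ g x)
      ≈⟨ ext-coefficient _≟ᴬ_ g {w} (deduplicate-! _≟ᴬ_ keys) (λ y∈ → ∈-deduplicate⁺ _≟ᴬ_ (∈-++⁺ʳ (map proj₂ v) y∈)) ⟨
    ext g w ∎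
    where
    keys : List A
    keys = map proj₂ v ++ map proj₂ w

  ⟪⟫-ext : ∀ x f → ⟪ x , f ⟫ ≈ ext (f ∘ parts) x
  ⟪⟫-ext []            f = ≈-refl
  ⟪⟫-ext ((k , α) ∷ x) f = +-congˡ (⟪⟫-ext x f)

  -- The coefficient of `M α` in `𝒮 β`, an analogue of the Kostka numbers. Its linear extension in α
  -- is the pairing with `𝒮 β`.
  K : Composition → Composition → Carrier
  K β α = 𝒮 β (parts α)

  ∑-length : ∀ (f : A → List B) xs → length (concatMap f xs) ×ᶠ 1# ≈ ∑ᶠ xs (λ x → length (f x) ×ᶠ 1#)
  ∑-length f []       = ≈-refl
  ∑-length f (x ∷ xs) = ≈-trans (≈-reflexive (≡.cong (_×ᶠ 1#) (length-++ (f x))))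
    (≈-trans (×-homo-+ 1# (length (f x)) _) (+-congˡ (∑-length f xs)))

  -- For positive n, the first exponent of the word is n, and the tableaux are counted by
  -- `tableaux-count`. For n = 0 no letter is added, which matches the trivial strip.
  K-generator : ∀ n γ β → K β (generator n ++ γ) ≈ ∑ᶠ (LH-to n β) (λ α → K α γ)
  K-generator zero γ β = ≈-sym (∑-single (stripsTo-unique ℕ._<?_ 0 β)
    (Strip⇒to strictOrder {0} {β} {β} ([] , V.[] , refl))
    λ {α} α∈ α≢β → contradiction (LH₀ (to⇒Strip strictOrder {0} {α} {β} α∈)) α≢β)
  K-generator (suc n) γ β = ≈-trans
    (≈-reflexive (≡.cong (_×ᶠ 1#) (tableaux-count {suc n} {length (parts γ)} {parts γ} β)))
    (∑-length (tableaux (length (parts γ)) (parts γ)) (LH-to (suc n) β))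

  K-[] : ∀ β → K β [] ≈ 𝟙 ([] ≟ β)
  K-[] []                 = +-identityʳ _
  K-[] (part (suc n) ∷ β) = ≈-refl

  ext-∙ : ∀ p x y → ext p (x ∙ y) ≈ ext (λ u → ext (λ v → p (u ++ v)) y) x
  ext-∙ p x y = ext-bilinear p _++_ x y

  Δ-word : Composition → NSym⊗NSym
  Δ-word = foldr (λ r → ΔH r ∙⊗_) (basis ([] , []))

  H-generator : ∀ n → H n ≡ basis (generator n)
  H-generator zero    = refl
  H-generator (suc n) = refl

  ext-Δ-word : ∀ g n γ → ext g (Δ-word (generator n ++ γ)) ≈
    ∑ᶠ (splits n) (λ (i , j) → ext (λ (u , v) → g (generator i ++ u , generator j ++ v)) (Δ-word γ))
  ext-Δ-word g zero    γ = ≈-sym (+-identityʳ _)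
  ext-Δ-word g (suc n) γ = begin
    ext g (ΔH (part (suc n)) ∙⊗ Δ-word γ)
      ≈⟨ ext-bilinear g _ (ΔH (part (suc n))) (Δ-word γ) ⟩
    ext G (ΔH (part (suc n)))
      ≈⟨ ext-∑ G (splits (suc n)) (λ (i , j) → H i ⊗ H j) ⟩
    ∑ᶠ (splits (suc n)) (λ (i , j) → ext G (H i ⊗ H j))
      ≈⟨ ∑-cong (splits (suc n)) (λ (i , j) → ≈-trans
           (≈-reflexive (≡.cong₂ (λ x y → ext G (x ⊗ y)) (H-generator i) (H-generator j)))
           (≈-trans (+-identityʳ _) (≈-trans (*-congʳ (*-identityˡ _)) (*-identityˡ _)))) ⟩
    ∑ᶠ (splits (suc n)) (λ (i , j) → G (generator i , generator j)) ∎
    where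
    G : Composition × Composition → Carrier
    G (α , β) = ext (λ (u , v) → g (α ++ u , β ++ v)) (Δ-word γ)

  ∑-δ₀ : ∀ n (f : ℕ → Carrier) → ∑ᶠ (splits n) (λ (i , m) → δ₀ m *ᶠ f i) ≈ f n
  ∑-δ₀ zero    f = ≈-trans (+-identityʳ _) (*-identityˡ _)
  ∑-δ₀ (suc n) f = ≈-trans (∑-splits-sucʳ n _) (≈-trans
    (+-cong (*-identityˡ _) (∑-zero (splits n) λ _ → zeroˡ _)) (+-identityʳ _))

  -- As p ↦ (λ u → p (generator i ++ u)) is dual to left multiplication by Hᵢ,
  -- this is (∑ᵢ (-1)ⁱ Hᵢ)(∑ⱼ Xⱼ) = E for power series of linear functionals.
  GeneratorInverse : ((Composition → Carrier) → Carrier) → (ℕ → (Composition → Carrier) → Carrier) → Set _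
  GeneratorInverse E X = ∀ m p →
    ∑ᶠ (splits m) (λ (i , j) → sgn i *ᶠ X j (λ u → p (generator i ++ u))) ≈ δ₀ m *ᶠ E p

  -- The alternating series of generators has constant term 1, so the equation in degree n
  -- determines X n from the lower degrees. These occur at shifted functionals, which is why p
  -- varies in the induction.
  generatorInverse-unique : ∀ {E X Y} → GeneratorInverse E X → GeneratorInverse E Y →
    ∀ n p → X n p ≈ Y n p
  generatorInverse-unique {E} {X} {Y} x y n = below n n ℕ.≤-refl
    where
    -- m only bounds the degree and turns strong induction on n into structural recursion.
    below : ∀ m n → n ≤ m → ∀ p → X n p ≈ Y n p
    below m zero _ p = begin
      X 0 p                    ≈⟨ ≈-trans (+-identityʳ _) (*-identityˡ _) ⟨
      1# *ᶠ X 0 p +ᶠ 0#        ≈⟨ x 0 p ⟩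
      δ₀ 0 *ᶠ E p              ≈⟨ y 0 p ⟨
      1# *ᶠ Y 0 p +ᶠ 0#        ≈⟨ ≈-trans (+-identityʳ _) (*-identityˡ _) ⟩
      Y 0 p                    ∎
    below (suc m) (suc n) (s≤s n≤m) p = ∙-cancelʳ _ _ _ (begin
      X (suc n) p +ᶠ rest X       ≈⟨ +-congʳ (*-identityˡ _) ⟨
      1# *ᶠ X (suc n) p +ᶠ rest X ≈⟨ ∑-splits-suc n _ ⟨
      _                           ≈⟨ x (suc n) p ⟩
      δ₀ (suc n) *ᶠ E p           ≈⟨ y (suc n) p ⟨
      _                           ≈⟨ ∑-splits-suc n _ ⟩
      1# *ᶠ Y (suc n) p +ᶠ rest Y ≈⟨ +-congʳ (*-identityˡ _) ⟩
      Y (suc n) p +ᶠ rest Y       ≈⟨ +-congˡ (∑-splits-cong n λ i j i+j≡n → *-congˡ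
        (below m j (ℕ.≤-trans (≡.subst (j ≤_) i+j≡n (ℕ.m≤n+m j i)) n≤m) _)) ⟨
      Y (suc n) p +ᶠ rest X       ∎)
      where
      rest : (ℕ → (Composition → Carrier) → Carrier) → Carrier
      rest Z = ∑ᶠ (splits n) (λ (i , j) → sgn (suc i) *ᶠ Z j (λ u → p (generator (suc i) ++ u)))

  -- The Pieri rule, rows and columns

  module _ {s : Composition → NSym} (schur : IsNoncommutativeSchur s) where
    open IsNoncommutativeSchur schur
    open IsBasis isBasis using (spanning)

    ext-K-s : ∀ α β → ext (K β) (s α) ≈ δ α β
    ext-K-s α β = ≈-trans (≈-sym (⟪⟫-ext (s α) (𝒮 β))) (dual α β)

    -- By duality the pairings with all `𝒮 β` are the coordinates with respect to s. Spanning
    -- provides some coordinates l, and the pairings identify l with k.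
    expansion : ∀ p x k → (∀ β → ext (K β) x ≈ coefficient _≟_ k β) → ext p x ≈ ext (λ α → ext p (s α)) k
    expansion p x k eq with spanning x
    ... | l , l≈x = begin
      ext p x                     ≈⟨ ext-resp _≟_ p {linear s l} {x} l≈x ⟨
      ext p (linear s l)          ≈⟨ ext-linear p s l ⟩
      ext (λ α → ext p (s α)) l   ≈⟨ ext-resp _≟_ _ {l} {k} l≈k ⟩
      ext (λ α → ext p (s α)) k   ∎
      where
      l≈k : l ≈ᴺ k
      l≈k β = begin
        coefficient _≟_ l β             ≈⟨ coefficient-ext _≟_ l β ⟩
        ext (λ α → δ α β) l             ≈⟨ ext-cong l (λ α → ext-K-s α β) ⟨
        ext (λ α → ext (K β) (s α)) l   ≈⟨ ext-linear (K β) s l ⟨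
        ext (K β) (linear s l)          ≈⟨ ext-resp _≟_ (K β) {linear s l} {x} l≈x ⟩
        ext (K β) x                     ≈⟨ eq β ⟩
        coefficient _≟_ k β             ∎

    s-[] : ∀ p → ext p (s []) ≈ p []
    s-[] p = begin
      ext p (s [])                          ≈⟨ ext-basis (λ α → ext p (s α)) [] ⟨
      ext (λ α → ext p (s α)) (basis [])    ≈⟨ expansion p (basis []) (basis []) eq ⟨
      ext p (basis [])                      ≈⟨ ext-basis p [] ⟩
      p []                                  ∎
      where
      eq : ∀ β → ext (K β) (basis []) ≈ coefficient _≟_ (basis []) β
      eq β = begin
        ext (K β) (basis [])            ≈⟨ ext-basis (K β) [] ⟩
        K β []                          ≈⟨ K-[] β ⟩
        𝟙 ([] ≟ β)                      ≈⟨ ext-basis (λ α → 𝟙 (α ≟ β)) [] ⟨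
        ext (λ α → 𝟙 (α ≟ β)) (basis []) ≈⟨ coefficient-ext _≟_ (basis []) β ⟨
        coefficient _≟_ (basis []) β    ∎

    -- By `expansion`, both sides need only be paired with each `𝒮 β`. There the removal of ones
    -- gives a sum over strips into β, and `∑-from-to` turns it into one over strips out of α.
    pieri : ∀ p n α → ∑ᶠ (LH-from n α) (λ ρ → ext p (s ρ)) ≈ ext (λ u → p (generator n ++ u)) (s α)
    pieri p n α = begin
      ∑ᶠ (LH-from n α) (λ ρ → ext p (s ρ))
        ≈⟨ ∑-cong (LH-from n α) (λ ρ → ext-basis (λ β → ext p (s β)) ρ) ⟨
      ∑ᶠ (LH-from n α) (λ ρ → ext (λ β → ext p (s β)) (basis ρ))
        ≈⟨ ext-∑ _ (LH-from n α) basis ⟨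
      ext (λ β → ext p (s β)) (∑ (LH-from n α) basis)
        ≈⟨ expansion p (basis (generator n) ∙ s α) (∑ (LH-from n α) basis) eq ⟨
      ext p (basis (generator n) ∙ s α)
        ≈⟨ ext-generator p ⟩
      ext (λ u → p (generator n ++ u)) (s α) ∎
      where
      ext-generator : ∀ p → ext p (basis (generator n) ∙ s α) ≈ ext (λ u → p (generator n ++ u)) (s α)
      ext-generator p = ≈-trans (ext-∙ p (basis (generator n)) (s α)) (ext-basis (λ u → ext (λ v → p (u ++ v)) (s α)) (generator n))
      eq : ∀ β → ext (K β) (basis (generator n) ∙ s α) ≈ coefficient _≟_ (∑ (LH-from n α) basis) β
      eq β = begin
        ext (K β) (basis (generator n) ∙ s α)
          ≈⟨ ext-generator (K β) ⟩
        ext (λ u → K β (generator n ++ u)) (s α)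
          ≈⟨ ext-cong (s α) (λ u → K-generator n u β) ⟩
        ext (λ u → ∑ᶠ (LH-to n β) (λ θ → K θ u)) (s α)
          ≈⟨ ∑-ext (LH-to n β) K (s α) ⟩
        ∑ᶠ (LH-to n β) (λ θ → ext (K θ) (s α))
          ≈⟨ ∑-cong (LH-to n β) (λ θ → ≈-trans (ext-K-s α θ) (𝟙-cong (α ≟ θ) (θ ≟ α) ≡.sym ≡.sym)) ⟩
        ∑ᶠ (LH-to n β) (λ θ → 𝟙 (θ ≟ α))
          ≈⟨ ∑-from-to strictOrder n α β ⟨
        ∑ᶠ (LH-from n α) (λ ρ → 𝟙 (ρ ≟ β))
          ≈⟨ ∑-cong (LH-from n α) (λ ρ → ext-basis (λ γ → 𝟙 (γ ≟ β)) ρ) ⟨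
        ∑ᶠ (LH-from n α) (λ ρ → ext (λ γ → 𝟙 (γ ≟ β)) (basis ρ))
          ≈⟨ ext-∑ _ (LH-from n α) basis ⟨
        ext (λ γ → 𝟙 (γ ≟ β)) (∑ (LH-from n α) basis)
          ≈⟨ coefficient-ext _≟_ (∑ (LH-from n α) basis) β ⟨
        coefficient _≟_ (∑ (LH-from n α) basis) β ∎

    -- The Pieri rule at the empty composition has a single term, and `s []` is 1; so s of a row is
    -- the generator itself.
    s-row : ∀ p n → ext p (s (generator n)) ≈ p (generator n)
    s-row p n = begin
      ext p (s (generator n))
        ≈⟨ ∑-single (stripsFrom-unique ℕ._<?_ n []) (Strip⇒from strictOrder {n} {[]} ([]⟶LH n))
             (λ {β} β∈ β≢ → contradiction (LH-from-[] {n} {β} (from⇒Strip strictOrder {n} {[]} {β} β∈)) β≢) ⟨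
      ∑ᶠ (LH-from n []) (λ ρ → ext p (s ρ))        ≈⟨ pieri p n [] ⟩
      ext (λ u → p (generator n ++ u)) (s [])      ≈⟨ s-[] _ ⟩
      p (generator n ++ [])                        ≈⟨ ≈-reflexive (≡.cong p (++-identityʳ _)) ⟩
      p (generator n)                              ∎

    -- Brings s of a column into the form of a sum over vertical strips, to which `from-inverse`
    -- applies.
    s-column : ∀ p n → ∑ᶠ (LV-from n []) (λ ρ → ext p (s ρ)) ≈ ext p (s ⟨1^ n ⟩)
    s-column p n = ∑-single (stripsFrom-unique ℕ._≥?_ n []) (Strip⇒from weakOrder {n} {[]} ([]⟶LV n))
      λ {β} β∈ β≢ → contradiction (LV-from-[] {n} {β} (from⇒Strip weakOrder {n} {[]} {β} β∈)) β≢

    -- `pieri` turns each product into vertical strips out of the empty composition followed by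
    -- horizontal ones, and these cancel. So s of a column is the elementary generator.
    columns-generatorInverse : GeneratorInverse (λ p → p []) (λ n p → ext p (s ⟨1^ n ⟩))
    columns-generatorInverse m p = begin
      ∑ᶠ (splits m) (λ (i , j) → sgn i *ᶠ ext (λ u → p (generator i ++ u)) (s ⟨1^ j ⟩))
        ≈⟨ ∑-cong (splits m) (λ (i , j) → *-congˡ (≈-trans (≈-sym (s-column _ j))
             (∑-cong (LV-from j []) λ ρ → ≈-sym (pieri p i ρ)))) ⟩
      ∑ᶠ (splits m) (λ (i , j) → sgn i *ᶠ
        ∑ᶠ (LV-from j []) (λ ρ → ∑ᶠ (LH-from i ρ) (λ σ → ext p (s σ))))
        ≈⟨ ∑-splits-comm m (λ i j → sgn i *ᶠ
             ∑ᶠ (LV-from j []) (λ ρ → ∑ᶠ (LH-from i ρ) (λ σ → ext p (s σ)))) ⟩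
      ∑ᶠ (splits m) (λ (j , i) → sgn i *ᶠ
        ∑ᶠ (LV-from j []) (λ ρ → ∑ᶠ (LH-from i ρ) (λ σ → ext p (s σ))))
        ≈⟨ from-inverse weakOrder strictOrder ℕ.≤⇒≯ ℕ.≰⇒> m (λ σ → ext p (s σ)) [] ⟩
      δ₀ m *ᶠ ext p (s [])
        ≈⟨ *-congˡ (s-[] p) ⟩
      δ₀ m *ᶠ p [] ∎

    -- Skew elements and the two product formulas

    module _ {s[_/_] : Composition → Composition → NSym} (skew : IsSkew s s[_/_]) where
      open IsSkew skew
      open DecMembership _≟_ using (_∈?_)

      -- The tensor product of p with the pairing with `𝒮 μ`; by duality it extracts the skew
      -- element for μ from the coproduct.
      rightK : (Composition → Carrier) → Composition → Composition × Composition → Carrier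
      rightK p μ (u , v) = p u *ᶠ K μ v

      skew-ext : ∀ p α μ → ext (rightK p μ) (Δ (s α)) ≈ ext p s[ α / μ ]
      skew-ext p α μ = begin
        ext (rightK p μ) (Δ (s α))
          ≈⟨ ext-resp (×-≡-dec _≟_ _≟_) (rightK p μ) {Δ (s α)} {∑ (support α) λ η → s[ α / η ] ⊗ s η} (expand α) ⟩
        ext (rightK p μ) (∑ (support α) λ η → s[ α / η ] ⊗ s η)
          ≈⟨ ext-∑ (rightK p μ) (support α) (λ η → s[ α / η ] ⊗ s η) ⟩
        ∑ᶠ (support α) (λ η → ext (rightK p μ) (s[ α / η ] ⊗ s η))
          ≈⟨ ∑-cong (support α) (λ η → begin
               ext (rightK p μ) (s[ α / η ] ⊗ s η)
                 ≈⟨ ext-bilinear (rightK p μ) _,_ s[ α / η ] (s η) ⟩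
               ext (λ u → ext (λ v → p u *ᶠ K μ v) (s η)) s[ α / η ]
                 ≈⟨ ext-cong s[ α / η ] (λ u → ≈-trans (ext-*ˡ (p u) (K μ) (s η)) (*-congˡ (ext-K-s η μ))) ⟩
               ext (λ u → p u *ᶠ δ η μ) s[ α / η ]
                 ≈⟨ ext-*ʳ (δ η μ) p s[ α / η ] ⟩
               ext p s[ α / η ] *ᶠ δ η μ ∎) ⟩
        ∑ᶠ (support α) (λ η → ext p s[ α / η ] *ᶠ δ η μ)
          ≈⟨ select (μ ∈? support α) ⟩
        ext p s[ α / μ ] ∎
        where
        select : Dec (μ ∈ support α) →
          ∑ᶠ (support α) (λ η → ext p s[ α / η ] *ᶠ δ η μ) ≈ ext p s[ α / μ ]
        select (yes μ∈) = ≈-trans (∑-cong (support α) λ _ → *-comm _ _)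
          (∑-select _≟_ (λ η → ext p s[ α / η ]) (unique α) μ∈)
        select (no μ∉) = ≈-trans
          (∑-zero (support α) λ {η} η∈ → ≈-trans (*-congˡ (𝟙-no (η ≟ μ) λ { refl → μ∉ η∈ })) (zeroʳ _))
          (≈-sym (ext-resp _≟_ p {s[ α / μ ]} {[]} (zeros α μ μ∉)))

      -- Evaluates `rightK p μ` on Δ(Hₙ) Δ(s α), for each split (i, j) of n: the left factor Hᵢ is
      -- absorbed into p, and the right factor Hⱼ is removed from `K μ` by `K-generator`.
      skew-pieri : ∀ p n α μ → ∑ᶠ (LH-from n α) (λ ρ → ext p s[ ρ / μ ]) ≈
        ∑ᶠ (splits n) (λ (i , j) → ∑ᶠ (LH-to j μ) (λ θ → ext (λ u → p (generator i ++ u)) s[ α / θ ]))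
      skew-pieri p n α μ = begin
        ∑ᶠ (LH-from n α) (λ ρ → ext p s[ ρ / μ ])
          ≈⟨ ∑-cong (LH-from n α) (λ ρ → ≈-trans (≈-sym (skew-ext p ρ μ)) (ext-linear (rightK p μ) Δ-word (s ρ))) ⟩
        ∑ᶠ (LH-from n α) (λ ρ → ext (λ γ → ext (rightK p μ) (Δ-word γ)) (s ρ))
          ≈⟨ pieri _ n α ⟩
        ext (λ γ → ext (rightK p μ) (Δ-word (generator n ++ γ))) (s α)
          ≈⟨ ext-cong (s α) (λ γ → ≈-trans (ext-Δ-word (rightK p μ) n γ) (∑-cong (splits n) λ (i , j) → distribute i j γ)) ⟩
        ext (λ γ → ∑ᶠ (splits n) (λ (i , j) → ∑ᶠ (LH-to j μ) (λ θ → ext (rightK (p ∘ (generator i ++_)) θ) (Δ-word γ)))) (s α)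
          ≈⟨ ∑-ext (splits n) _ (s α) ⟩
        ∑ᶠ (splits n) (λ (i , j) → ext (λ γ → ∑ᶠ (LH-to j μ) (λ θ → ext (rightK (p ∘ (generator i ++_)) θ) (Δ-word γ))) (s α))
          ≈⟨ ∑-cong (splits n) (λ (i , j) → ≈-trans (∑-ext (LH-to j μ) _ (s α)) (∑-cong (LH-to j μ) λ θ →
               ≈-trans (≈-sym (ext-linear (rightK (p ∘ (generator i ++_)) θ) Δ-word (s α))) (skew-ext _ α θ))) ⟩
        ∑ᶠ (splits n) (λ (i , j) → ∑ᶠ (LH-to j μ) (λ θ → ext (λ u → p (generator i ++ u)) s[ α / θ ])) ∎
        where
        distribute : ∀ i j γ → ext (λ (u , v) → p (generator i ++ u) *ᶠ K μ (generator j ++ v)) (Δ-word γ) ≈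
          ∑ᶠ (LH-to j μ) (λ θ → ext (rightK (p ∘ (generator i ++_)) θ) (Δ-word γ))
        distribute i j γ = ≈-trans
          (ext-cong (Δ-word γ) λ (u , v) → ≈-trans (*-congˡ (K-generator j v μ)) (∑-*ˡ _ (LH-to j μ) _))
          (∑-ext (LH-to j μ) _ (Δ-word γ))

      module _ (lam η : Composition) where

        -- After `skew-pieri` the horizontal strips out of `lam` have become strips of size j
        -- stacked under the vertical strips of size b into η. For fixed j + b = m these cancel by
        -- `to-inverse` unless m = 0, where i = n.
        strips-generator : ∀ n p →
          ∑ᶠ (splits n) (λ (a , b) → sgn b *ᶠ
            ∑ᶠ (LH-from a lam) (λ ρ → ∑ᶠ (LV-to b η) (λ μ → ext p s[ ρ / μ ]))) ≈
          ext (λ u → p (generator n ++ u)) s[ lam / η ]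
        strips-generator n p = begin
          ∑ᶠ (splits n) (λ (a , b) → sgn b *ᶠ
            ∑ᶠ (LH-from a lam) (λ ρ → ∑ᶠ (LV-to b η) (λ μ → ext p s[ ρ / μ ])))
            ≈⟨ ∑-cong (splits n) (λ (a , b) → ≈-trans
                 (*-congˡ (≈-trans (∑-swap (LH-from a lam) (LV-to b η) _) (≈-trans
                   (∑-cong (LV-to b η) λ μ → skew-pieri p a lam μ)
                   (∑-swap (LV-to b η) (splits a) _))))
                 (∑-*ˡ (sgn b) (splits a) _)) ⟩
          ∑ᶠ (splits n) (λ (a , b) → ∑ᶠ (splits a) (λ (i , j) → G i j b))
            ≈⟨ ∑-splits-assoc n G ⟩
          ∑ᶠ (splits n) (λ (i , m) → ∑ᶠ (splits m) (λ (j , b) → G i j b))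
            ≈⟨ ∑-cong (splits n) (λ (i , m) → to-inverse strictOrder weakOrder ℕ.<⇒≱ ℕ.≮⇒≥ m
                 (λ θ → ext (λ u → p (generator i ++ u)) s[ lam / θ ]) η) ⟩
          ∑ᶠ (splits n) (λ (i , m) → δ₀ m *ᶠ ext (λ u → p (generator i ++ u)) s[ lam / η ])
            ≈⟨ ∑-δ₀ n (λ i → ext (λ u → p (generator i ++ u)) s[ lam / η ]) ⟩
          ext (λ u → p (generator n ++ u)) s[ lam / η ] ∎
          where
          G : ℕ → ℕ → ℕ → Carrier
          G i j b = sgn b *ᶠ ∑ᶠ (LV-to b η) (λ μ → ∑ᶠ (LH-to j μ) (λ θ →
            ext (λ u → p (generator i ++ u)) s[ lam / θ ]))

        productValue stripsValue : ℕ → (Composition → Carrier) → Carrier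
        productValue n p = ext (λ u → ext (λ v → p (u ++ v)) s[ lam / η ]) (s ⟨1^ n ⟩)
        stripsValue n p = ∑ᶠ (splits n) (λ (a , b) → sgn b *ᶠ
          ∑ᶠ (LV-from a lam) (λ ρ → ∑ᶠ (LH-to b η) (λ μ → ext p s[ ρ / μ ])))

        -- The relation for the columns multiplied on the right by the skew element, which at the
        -- level of functionals means a change of p.
        product-generatorInverse : GeneratorInverse (λ p → ext p s[ lam / η ]) productValue
        product-generatorInverse m p = ≈-trans
          (∑-cong (splits m) λ (i , j) → *-congˡ (ext-cong (s ⟨1^ j ⟩) λ u → ext-cong s[ lam / η ] λ v →
            ≈-reflexive (≡.cong p (≡.sym (++-assoc (generator i) u v)))))
          (columns-generatorInverse m (λ u → ext (λ v → p (u ++ v)) s[ lam / η ]))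

        -- For a fixed vertical strip from `lam` to ρ, the prefixes Hᵢ and the horizontal strips of
        -- size b into η carry the sign of i + b. Read from right to left, `skew-pieri` merges them
        -- into horizontal strips out of ρ, so vertical strips followed by horizontal ones remain,
        -- and these cancel.
        strips-generatorInverse : GeneratorInverse (λ p → ext p s[ lam / η ]) stripsValue
        strips-generatorInverse m p = begin
          ∑ᶠ (splits m) (λ (i , j) → sgn i *ᶠ ∑ᶠ (splits j) (λ (a , b) → sgn b *ᶠ G i a b))
            ≈⟨ ∑-cong (splits m) (λ (i , j) → ∑-*ˡ (sgn i) (splits j) _) ⟩
          ∑ᶠ (splits m) (λ (i , j) → ∑ᶠ (splits j) (λ (a , b) → sgn i *ᶠ (sgn b *ᶠ G i a b)))
            -- Three reindexings bring the size a of the vertical strip outermost: i, (a, b) becomes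
            -- (i, a), b, then (a, i), b, then a, (i, b).
            ≈⟨ ∑-splits-assoc m (λ i a b → sgn i *ᶠ (sgn b *ᶠ G i a b)) ⟨
          ∑ᶠ (splits m) (λ (c , b) → ∑ᶠ (splits c) (λ (i , a) → sgn i *ᶠ (sgn b *ᶠ G i a b)))
            ≈⟨ ∑-cong (splits m) (λ (c , b) → ∑-splits-comm c (λ i a → sgn i *ᶠ (sgn b *ᶠ G i a b))) ⟩
          ∑ᶠ (splits m) (λ (c , b) → ∑ᶠ (splits c) (λ (a , i) → sgn i *ᶠ (sgn b *ᶠ G i a b)))
            ≈⟨ ∑-splits-assoc m (λ a i b → sgn i *ᶠ (sgn b *ᶠ G i a b)) ⟩
          ∑ᶠ (splits m) (λ (a , c) → ∑ᶠ (splits c) (λ (i , b) → sgn i *ᶠ (sgn b *ᶠ G i a b)))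
            ≈⟨ ∑-cong (splits m) (λ (a , c) → collect a c) ⟩
          ∑ᶠ (splits m) (λ (a , c) → sgn c *ᶠ
            ∑ᶠ (LV-from a lam) (λ ρ → ∑ᶠ (LH-from c ρ) (λ σ → ext p s[ σ / η ])))
            ≈⟨ from-inverse weakOrder strictOrder ℕ.≤⇒≯ ℕ.≰⇒> m (λ σ → ext p s[ σ / η ]) lam ⟩
          δ₀ m *ᶠ ext p s[ lam / η ] ∎
          where
          G : ℕ → ℕ → ℕ → Carrier
          G i a b = ∑ᶠ (LV-from a lam) (λ ρ → ∑ᶠ (LH-to b η) (λ μ →
            ext (λ u → p (generator i ++ u)) s[ ρ / μ ]))

          collect : ∀ a c → ∑ᶠ (splits c) (λ (i , b) → sgn i *ᶠ (sgn b *ᶠ G i a b)) ≈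
            sgn c *ᶠ ∑ᶠ (LV-from a lam) (λ ρ → ∑ᶠ (LH-from c ρ) (λ σ → ext p s[ σ / η ]))
          collect a c = begin
            ∑ᶠ (splits c) (λ (i , b) → sgn i *ᶠ (sgn b *ᶠ G i a b))
              ≈⟨ ∑-splits-cong c (λ i b i+b≡c → ≈-trans (≈-sym (*-assoc _ _ _))
                   (*-congʳ (≈-trans (≈-sym (sgn-+ i b)) (≈-reflexive (≡.cong sgn i+b≡c))))) ⟩
            ∑ᶠ (splits c) (λ (i , b) → sgn c *ᶠ G i a b)
              ≈⟨ ∑-*ˡ (sgn c) (splits c) _ ⟨
            sgn c *ᶠ ∑ᶠ (splits c) (λ (i , b) → G i a b)
              ≈⟨ *-congˡ (≈-trans (∑-swap (splits c) (LV-from a lam) _)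
                   (∑-cong (LV-from a lam) λ ρ → ≈-sym (skew-pieri p c ρ η))) ⟩
            sgn c *ᶠ ∑ᶠ (LV-from a lam) (λ ρ → ∑ᶠ (LH-from c ρ) (λ σ → ext p s[ σ / η ])) ∎

        strips : ℕ → (from to : ℕ → List Composition) → NSym
        strips n from to = ∑ (splits n) λ (a , b) → (- 1#) ^ b · ∑ (from a) λ ρ → ∑ (to b) λ μ → s[ ρ / μ ]

        ext-strips : ∀ p n from to → ext p (strips n from to) ≈
          ∑ᶠ (splits n) (λ (a , b) → sgn b *ᶠ ∑ᶠ (from a) (λ ρ → ∑ᶠ (to b) (λ μ → ext p s[ ρ / μ ])))
        ext-strips p n from to = ≈-trans
          (ext-∑ p (splits n) λ (a , b) → (- 1#) ^ b · ∑ (from a) λ ρ → ∑ (to b) λ μ → s[ ρ / μ ])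
          (∑-cong (splits n) λ (a , b) → ≈-trans
            (ext-· p (sgn b) (∑ (from a) λ ρ → ∑ (to b) λ μ → s[ ρ / μ ]))
            (*-congˡ (≈-trans (ext-∑ p (from a) λ ρ → ∑ (to b) λ μ → s[ ρ / μ ])
              (∑-cong (from a) λ ρ → ext-∑ p (to b) λ μ → s[ ρ / μ ]))))

        rows-product : ∀ n .{{_ : NonZero n}} → s ⟨ n ⟩ ∙ s[ lam / η ] ≈ᴺ
          strips n (λ a → LH-from a lam) (λ b → LV-to b η)
        -- Matching on the successor makes `⟨ n ⟩` and `generator n` the same word by computation.
        rows-product n@(suc _) = ≈ᴺ-ext {s ⟨ n ⟩ ∙ s[ lam / η ]} {strips n (λ a → LH-from a lam) (λ b → LV-to b η)} λ p → begin
          ext p (s ⟨ n ⟩ ∙ s[ lam / η ])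
            ≈⟨ ext-∙ p (s ⟨ n ⟩) s[ lam / η ] ⟩
          ext (λ u → ext (λ v → p (u ++ v)) s[ lam / η ]) (s ⟨ n ⟩)
            ≈⟨ s-row _ n ⟩
          ext (λ v → p (generator n ++ v)) s[ lam / η ]
            ≈⟨ strips-generator n p ⟨
          _
            ≈⟨ ext-strips p n (λ a → LH-from a lam) (λ b → LV-to b η) ⟨
          _ ∎

        columns-product : ∀ n → s ⟨1^ n ⟩ ∙ s[ lam / η ] ≈ᴺ
          strips n (λ a → LV-from a lam) (λ b → LH-to b η)
        columns-product n = ≈ᴺ-ext {s ⟨1^ n ⟩ ∙ s[ lam / η ]} {strips n (λ a → LV-from a lam) (λ b → LH-to b η)} λ p → begin
          ext p (s ⟨1^ n ⟩ ∙ s[ lam / η ])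
            ≈⟨ ext-∙ p (s ⟨1^ n ⟩) s[ lam / η ] ⟩
          ext (λ u → ext (λ v → p (u ++ v)) s[ lam / η ]) (s ⟨1^ n ⟩)
            ≈⟨ generatorInverse-unique {X = productValue} {stripsValue} product-generatorInverse strips-generatorInverse n p ⟩
          _
            ≈⟨ ext-strips p n (λ a → LV-from a lam) (λ b → LH-to b η) ⟨
          _ ∎

corollary5p3 : ∀ {c ℓ₁ ℓ₂} (F : HeytingField c ℓ₁ ℓ₂) →
    let open Over F in
    CharacteristicZero →
    (s : Composition → NSym) → IsNoncommutativeSchur s →
    (s[_/_] : Composition → Composition → NSym) → IsSkew s s[_/_] →
    (n : ℕ) .{{_ : NonZero n}} (lam η : Composition) →
    (s ⟨ n ⟩ ∙ s[ lam / η ] ≈ᴺ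
    ∑ (splits n) λ (a , b) → (- 1#) ^ b ·
    ∑ (LH-from a lam) λ ρ → ∑ (LV-to b η) λ μ → s[ ρ / μ ])
    ×
    (s ⟨1^ n ⟩ ∙ s[ lam / η ] ≈ᴺ
    ∑ (splits n) λ (a , b) → (- 1#) ^ b ·
    ∑ (LV-from a lam) λ ρ → ∑ (LH-to b η) λ μ → s[ ρ / μ ])
corollary5p3 F _ s schur s[_/_] skew n lam η =
  rows-product schur skew lam η n , columns-product schur skew lam η n
  where open Proof F
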